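{- Let $k\geq 4$ and $n>k$ be integers. If $G$ is a $2$-connected graph on $n$ vertices with chromatic number $\chi(G)=k$, independence number $\alpha(G)=2$ and connectivity $\kappa(G)=2$, then for every integer $x\geq k$, $$P(G,x)\leq (x-1)_{k-1}\big((x-1)^{n-k+1}+(-1)^{n-k}\big),$$ with equality if and only if $G\cong G_{k+1,k}$ or $G\cong G_{k+2,k}$.
   Context: All graphs are finite and simple. $P(G,x)$ denotes the chromatic polynomial of $G$, i.e., for a positive integer $x$ the number of proper colorings $c:V(G)\to\{1,\dots,x\}$. $(x)_m=x(x-1)\cdots(x-m+1)$ denotes the falling factorial. $\alpha(G)$ is the independence number and $\kappa(G)$ the vertex connectivity. For $m\ge k$, $G_{m,k}$ is the graph on $m$ vertices obtained from a $k$-clique by adding a path with $m-k$ new internal vertices (each of degree $2$) whose endpoints are two distinct vertices of the clique. -}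

module Defs where

open import Data.Nat using (ℕ; zero; suc; _+_; _*_; _∸_; _<_; _≤_; _≡ᵇ_; _<ᵇ_; _≤ᵇ_)
open import Data.Bool using (Bool; true; false; _∧_; _∨_; not)
import Data.Bool.Properties as BP
open import Data.Fin using (Fin; toℕ)
open import Data.Fin.Properties using (all?)
import Data.Fin.Properties as FP
open import Data.Fin.Subset using (Subset; _∈_; _∉_; ∣_∣)
open import Data.List using (List; []; _∷_; map; concatMap; filter; length)
open import Data.Vec.Functional using () renaming (_∷_ to _∷ᶠ_)
open import Data.Product using (Σ; _×_; _,_; ∃)
open import Data.Sum using (_⊎_)
open import Function.Bundles using (_↔_; Inverse)
open import Relation.Nullary using (¬_; Dec; yes; no; does; ¬?)
open import Relation.Nullary.Decidable.Core using (_→-dec_)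
open import Relation.Binary.PropositionalEquality using (_≡_; _≢_; refl; sym)

record Graph (n : ℕ) : Set where
  field
    adj     : Fin n → Fin n → Bool
    adj-sym : ∀ u v → adj u v ≡ adj v u
    irrefl  : ∀ v → adj v v ≡ false
open Graph public

Adj : ∀ {n} → Graph n → Fin n → Fin n → Set
Adj G u v = adj G u v ≡ true

Proper : ∀ {n x} → Graph n → (Fin n → Fin x) → Set
Proper G c = ∀ u v → Adj G u v → c u ≢ c v

proper? : ∀ {n x} (G : Graph n) (c : Fin n → Fin x) → Dec (Proper G c)
proper? G c = all? λ u → all? λ v →
  (adj G u v Data.Bool.≟ true) →-dec ¬? (c u FP.≟ c v)

allFuns : (n x : ℕ) → List (Fin n → Fin x)
allFuns zero    x = (λ ()) ∷ []
allFuns (suc n) x =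
  concatMap (λ a → map (λ f → a ∷ᶠ f) (allFuns n x)) (Data.List.allFin x)

chromPoly : ∀ {n} → Graph n → ℕ → ℕ
chromPoly {n} G x = length (filter (proper? G) (allFuns n x))

Colourable : ∀ {n} → Graph n → ℕ → Set
Colourable {n} G x = Σ (Fin n → Fin x) (Proper G)

ChromaticNumber : ∀ {n} → Graph n → ℕ → Set
ChromaticNumber G k = Colourable G k × (∀ j → j < k → ¬ Colourable G j)

Independent : ∀ {n} → Graph n → Subset n → Set
Independent G S = ∀ u v → u ∈ S → v ∈ S → ¬ Adj G u v

IndependenceNumber : ∀ {n} → Graph n → ℕ → Set
IndependenceNumber G a =
  Σ _ (λ S → Independent G S × ∣ S ∣ ≡ a) ×
  (∀ S → Independent G S → ∣ S ∣ ≤ a)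

data Reach {n} (G : Graph n) (S : Subset n) : Fin n → Fin n → Set where
  here : ∀ {u} → Reach G S u u
  step : ∀ {u v w} → Adj G u v → v ∉ S → Reach G S v w → Reach G S u w

ConnectedWithout : ∀ {n} → Graph n → Subset n → Set
ConnectedWithout G S = ∀ u v → u ∉ S → v ∉ S → Reach G S u v

KConnected : ∀ {n} → Graph n → ℕ → Set
KConnected {n} G k = k < n × (∀ S → ∣ S ∣ < k → ConnectedWithout G S)

Connectivity : ∀ {n} → Graph n → ℕ → Set
Connectivity G c = KConnected G c × ¬ KConnected G (suc c)

_≅_ : ∀ {n m} → Graph n → Graph m → Set
_≅_ {n} {m} G H =
  Σ (Fin n ↔ Fin m) λ f → ∀ u v → adj G u v ≡ adj H (Inverse.to f u) (Inverse.to f v)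

-- G_{m,k}: clique on vertices 0..k-1, plus the path
-- 0 — k — k+1 — … — (m-1) — 1   (internal vertices k..m-1)

gEdge : ℕ → ℕ → ℕ → ℕ → Bool
gEdge m k i j =
     ((i <ᵇ k) ∧ (j <ᵇ k))
  ∨ ((k ≤ᵇ i) ∧ (j ≡ᵇ suc i) ∧ (j <ᵇ m))
  ∨ ((k <ᵇ m) ∧ (i ≡ᵇ 0) ∧ (j ≡ᵇ k))
  ∨ ((k <ᵇ m) ∧ (i ≡ᵇ 1) ∧ (suc j ≡ᵇ m))

gAdj : (m k : ℕ) → Fin m → Fin m → Bool
gAdj m k u v = not (does (u FP.≟ v)) ∧ (gEdge m k (toℕ u) (toℕ v) ∨ gEdge m k (toℕ v) (toℕ u))

gAdj-irrefl : ∀ m k (v : Fin m) → gAdj m k v v ≡ false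
gAdj-irrefl m k v with v FP.≟ v
... | yes _ = refl
... | no ¬p with ¬p refl
... | ()

gAdj-sym : ∀ m k (u v : Fin m) → gAdj m k u v ≡ gAdj m k v u
gAdj-sym m k u v with u FP.≟ v | v FP.≟ u
... | yes refl | yes _ = refl
... | yes refl | no ¬p with ¬p refl
... | ()
gAdj-sym m k u v | no ¬p | yes refl with ¬p refl
... | ()
gAdj-sym m k u v | no _ | no _ = BP.∨-comm (gEdge m k (toℕ u) (toℕ v)) (gEdge m k (toℕ v) (toℕ u))

Gmk : (m k : ℕ) → Graph m
Gmk m k = record { adj = gAdj m k ; adj-sym = gAdj-sym m k ; irrefl = gAdj-irrefl m k }

falling : ℕ → ℕ → ℕ
falling x zero    = 1
falling x (suc m) = x * falling (x ∸ 1) m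

{-# OPTIONS --safe #-}

-- Remove vertices one at a time: a vertex joined to d pairwise adjacent remaining vertices
-- multiplies the number of colourings by at most x − d.  Write the bound as (x)ₖ · q(n − k),
-- where q(l + 2) = (x − 2)(x − 1)^(l+1) + q(l).  If G has a k-clique K, then attaching the
-- other n − k ≥ 2 vertices along edges costs at most (x − 1) each, and a single triangle step
-- saves enough to fall below the bound.  If every vertex outside K has at most one neighbour in
-- K, then α = 2 makes the outside a clique, so a triangle step is missing only when there are just
-- two such vertices, which is G_{k+2,k}.  One vertex outside K gives G_{k+1,k} or a further saving.
--
-- A k-clique almost always exists.  A separating pair {u, v} leaves two cliques A and B, and by
-- α = 2 each of u, v is joined to all of A or all of B.  Letting A and B share their colours gives
-- colourings that match a clique, except when u ≁ v are both joined to all of A, neither to all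
-- of B, and k = |A| + 2 = |B| + 1.  There the colourings with c(u) = c(v) and those with
-- c(u) ≠ c(v) are counted separately, and both counts are governed by a k-clique again.
module Submission where

open import Defs
open import Data.Bool using (Bool; true; false; if_then_else_; not; T; _∧_; _∨_)
open import Data.Bool.Properties using (T-∨; T-∧; T-≡; ¬-not)
open import Data.Empty using (⊥; ⊥-elim)
open import Data.Fin using (Fin; zero; suc; toℕ; fromℕ; inject₁; inject≤; punchIn; punchOut; _↑ˡ_; _↑ʳ_)
open import Data.Fin.Permutation using (↔⇒≡)
import Data.Fin.Properties as FP
open import Data.Fin.Subset using (Subset; ⁅_⁆; _∪_; _-_; ∣_∣; _∈_; _∉_; _⊆_) renaming (⊥ to ∅)
open import Data.Fin.Subset.Properties
open import Data.List using (List; []; _∷_; map; concatMap; filter; length; allFin; _++_)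
open import Data.List.Properties using (map-tabulate)
open import Data.Nat using (ℕ; zero; suc; _+_; _*_; _∸_; _⊔_; _≤_; _<_; z≤n; s≤s; s≤s⁻¹; z<s; _≤?_; _<?_; _<ᵇ_; _≤ᵇ_; _≡ᵇ_; >-nonZero) renaming (_^_ to _^ℕ_)
open import Data.Nat.ListAction using (sum)
open import Data.Nat.Properties
open import Data.Nat.Tactic.RingSolver using (solve-∀)
open import Data.Product using (Σ; ∃; _×_; _,_; proj₁; proj₂; map₂)
open import Data.Sum using (_⊎_; inj₁; inj₂; [_,_]′; swap)
open import Data.Vec.Functional using () renaming (_∷_ to _∷ᶠ_; [] to []ᶠ)
open import Function using (_∘_; id)
open import Function.Bundles using (_⇔_; mk⇔; Inverse; mk↔ₛ′; Equivalence)
open import Function.Construct.Composition using (_↔-∘_)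
open import Function.Definitions using (Injective)
open import Relation.Binary.PropositionalEquality hiding ([_])
open import Relation.Nullary using (¬_; Dec; yes; no; does; ¬?)
open import Relation.Nullary.Decidable using (_→-dec_; _×-dec_; _⊎-dec_; dec-true; dec-false; decidable-stable)
open import Relation.Unary using (Decidable)

-- The factor q is that of a cycle: G_{k+l,k} is a k-clique and an (l + 2)-cycle glued along an
-- edge, and x(x - 1)q(l) counts the colourings of that cycle (a single edge for l = 0). Advancing l
-- by two squares the sign away, so every estimate stays in ℕ. The leading term (x - 2)(x - 1)^(l+1)
-- of q(l + 2) is the cost of l + 2 vertices with a single triangle step, so the remainder q(l) > 0
-- makes each such estimate strict.
--
-- The 5-cycle shows what k ≥ 4 excludes: it has k = 3, is exceptional with |A| = 1 and |B| = 2, and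
-- has 30 colourings at x = 3 against a bound of 18. For k ≥ 4 one has |B| ≥ 3, which gives a
-- triangle between B and one of u, v, and |A| ≥ 2, which gives a spare factor x - 2. Splitting by
-- c(u) = c(v) is affordable because the two estimates are in the ratio 1 : x - 2 and add up through
-- 1 + (x - 2) = x - 1.

private variable
  m n t x d r : ℕ
  X Y : Set


-- Finite enumerations

Inj : (Fin m → Fin n) → Set
Inj f = Injective _≡_ _≡_ f

Surj : (Fin m → Fin n) → Set
Surj f = ∀ y → ∃ λ i → f i ≡ y

inj⇒surj : (f : Fin n → Fin n) → Inj f → Surj f
inj⇒surj {suc n} f f-inj y with FP.any? (λ i → f i FP.≟ y)
... | yes hit = hit
... | no miss = ⊥-elim (1+n≰n (FP.injective⇒≤ {f = λ i → punchOut (y≢f i)} λ {i} {j} e →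
        f-inj (FP.punchOut-injective (y≢f i) (y≢f j) e)))
  where
  y≢f : ∀ i → y ≢ f i
  y≢f i e = miss (i , sym e)

surj⇒≥ : (f : Fin m → Fin n) → Surj f → n ≤ m
surj⇒≥ f f-surj = FP.injective⇒≤ {f = λ y → proj₁ (f-surj y)} λ {y} {z} e →
  trans (sym (proj₂ (f-surj y))) (trans (cong f e) (proj₂ (f-surj z)))

infixr 5 _⊕_
-- Recursion on the left block makes `τ ⊕ σ` unfold to a `_∷ᶠ_`, the form from which the one-vertex
-- estimates peel the head.
_⊕_ : (Fin t → X) → (Fin m → X) → Fin (t + m) → X
_⊕_ {zero}  τ σ = σ
_⊕_ {suc t} τ σ = τ zero ∷ᶠ ((τ ∘ suc) ⊕ σ)

⊕-left : (τ : Fin t → X) (σ : Fin m → X) (i : Fin t) → ∃ λ j → (τ ⊕ σ) j ≡ τ i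
⊕-left τ σ zero    = zero , refl
⊕-left τ σ (suc i) = let j , e = ⊕-left (τ ∘ suc) σ i in suc j , e

⊕-right : (τ : Fin t → X) (σ : Fin m → X) (i : Fin m) → ∃ λ j → (τ ⊕ σ) j ≡ σ i
⊕-right {zero}  τ σ i = i , refl
⊕-right {suc t} τ σ i = let j , e = ⊕-right (τ ∘ suc) σ i in suc j , e

⊕-case : (τ : Fin t → X) (σ : Fin m → X) (j : Fin (t + m)) →
  (∃ λ i → (τ ⊕ σ) j ≡ τ i) ⊎ (∃ λ i → (τ ⊕ σ) j ≡ σ i)
⊕-case {zero}  τ σ j       = inj₂ (j , refl)
⊕-case {suc t} τ σ zero    = inj₁ (zero , refl)
⊕-case {suc t} τ σ (suc j) with ⊕-case (τ ∘ suc) σ j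
... | inj₁ (i , e) = inj₁ (suc i , e)
... | inj₂ ie      = inj₂ ie

∷-inj : {σ : Fin m → Fin n} {v : Fin n} → Inj σ → (∀ i → v ≢ σ i) → Inj (v ∷ᶠ σ)
∷-inj σ-inj v∉ {zero}  {zero}  e = refl
∷-inj σ-inj v∉ {zero}  {suc j} e = ⊥-elim (v∉ j e)
∷-inj σ-inj v∉ {suc i} {zero}  e = ⊥-elim (v∉ i (sym e))
∷-inj σ-inj v∉ {suc i} {suc j} e = cong suc (σ-inj e)

⊕-inj : {τ : Fin t → Fin n} {σ : Fin m → Fin n} →
  Inj τ → Inj σ → (∀ i j → τ i ≢ σ j) → Inj (τ ⊕ σ)
⊕-inj {zero}  τ-inj σ-inj disj = σ-inj
⊕-inj {suc t} {τ = τ} {σ} τ-inj σ-inj disj =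
  ∷-inj (⊕-inj (FP.suc-injective ∘ τ-inj) σ-inj (disj ∘ suc)) head∉
  where
  head∉ : ∀ j → τ zero ≢ ((τ ∘ suc) ⊕ σ) j
  head∉ j e with ⊕-case (τ ∘ suc) σ j
  ... | inj₁ (i , e′) = FP.0≢1+n (τ-inj (trans e e′))
  ... | inj₂ (i , e′) = disj zero i (trans e e′)

-- Serves both as a cardinality, through `size`, and as an ordered list of vertices, through `elem`,
-- from which cliques and removal orders are assembled.
record Enumeration {n} (P : Fin n → Set) : Set where
  field
    size     : ℕ
    elem     : Fin size → Fin n
    elem-inj : Inj elem
    sound    : ∀ i → P (elem i)
    complete : ∀ v → P v → ∃ λ i → elem i ≡ v
open Enumeration public

enumerate : {P : Fin n → Set} → Decidable P → Enumeration P
enumerate {zero} P? = record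
  { size = 0 ; elem = λ () ; elem-inj = λ { {()} } ; sound = λ () ; complete = λ () }
enumerate {suc n} {P} P? with P? zero | enumerate (P? ∘ suc)
... | yes p | E = record
  { size     = suc (size E)
  ; elem     = zero ∷ᶠ (suc ∘ elem E)
  ; elem-inj = ∷-inj (elem-inj E ∘ FP.suc-injective) (λ _ ())
  ; sound    = λ { zero → p ; (suc i) → sound E i }
  ; complete = λ { zero _ → zero , refl
                 ; (suc v) q → let i , e = complete E v q in suc i , cong suc e } }
... | no ¬p | E = record
  { size     = size E
  ; elem     = suc ∘ elem E
  ; elem-inj = elem-inj E ∘ FP.suc-injective
  ; sound    = sound E
  ; complete = λ { zero q → ⊥-elim (¬p q)
                 ; (suc v) q → map₂ (cong suc) (complete E v q) } }

size-mono : {P Q : Fin n → Set} (E : Enumeration P) (F : Enumeration Q) →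
  (∀ v → P v → Q v) → size E ≤ size F
size-mono E F P⊆Q = FP.injective⇒≤ {f = λ i → proj₁ (at i)} λ {i} {j} e →
  elem-inj E (trans (sym (proj₂ (at i))) (trans (cong (elem F) e) (proj₂ (at j))))
  where
  at : ∀ i → ∃ λ j → elem F j ≡ elem E i
  at i = complete F (elem E i) (P⊆Q _ (sound E i))

size-cong : {P Q : Fin n → Set} (E : Enumeration P) (F : Enumeration Q) →
  (∀ v → P v → Q v) → (∀ v → Q v → P v) → size E ≡ size F
size-cong E F P⊆Q Q⊆P = ≤-antisym (size-mono E F P⊆Q) (size-mono F E Q⊆P)

-- Sums over lists

ind : {P : Set} → Dec P → ℕ
ind P? = if does P? then 1 else 0

ind-yes : {P : Set} (P? : Dec P) → P → ind P? ≡ 1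
ind-yes (yes _) _ = refl
ind-yes (no ¬p) p = ⊥-elim (¬p p)

ind-no : {P : Set} (P? : Dec P) → ¬ P → ind P? ≡ 0
ind-no (yes p) ¬p = ⊥-elim (¬p p)
ind-no (no _)  _  = refl

ind-× : {P Q R : Set} (P? : Dec P) (Q? : Dec Q) (R? : Dec R) →
  (P → Q × R) → (Q → R → P) → ind P? ≡ ind Q? * ind R?
ind-× P? (yes q) (yes r) f g = ind-yes P? (g q r)
ind-× P? (yes q) (no ¬r) f g = ind-no P? (¬r ∘ proj₂ ∘ f)
ind-× P? (no ¬q) R?      f g = ind-no P? (¬q ∘ proj₁ ∘ f)

ind-split : {P Q : Set} (P? : Dec P) (Q? : Dec Q) → ind P? ≡ ind (P? ×-dec Q?) + ind (P? ×-dec ¬? Q?)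
ind-split (yes _) (yes _) = refl
ind-split (yes _) (no _)  = refl
ind-split (no _)  (yes _) = refl
ind-split (no _)  (no _)  = refl

∑ : List X → (X → ℕ) → ℕ
∑ xs f = sum (map f xs)

∑-cong : (xs : List X) {f g : X → ℕ} → (∀ a → f a ≡ g a) → ∑ xs f ≡ ∑ xs g
∑-cong []       f≗g = refl
∑-cong (a ∷ xs) f≗g = cong₂ _+_ (f≗g a) (∑-cong xs f≗g)

∑-mono : (xs : List X) {f g : X → ℕ} → (∀ a → f a ≤ g a) → ∑ xs f ≤ ∑ xs g
∑-mono []       f≤g = z≤n
∑-mono (a ∷ xs) f≤g = +-mono-≤ (f≤g a) (∑-mono xs f≤g)

∑-*ʳ : (xs : List X) (f : X → ℕ) (c : ℕ) → ∑ xs (λ a → f a * c) ≡ ∑ xs f * c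
∑-*ʳ []       f c = refl
∑-*ʳ (a ∷ xs) f c = trans (cong (f a * c +_) (∑-*ʳ xs f c)) (sym (*-distribʳ-+ c (f a) (∑ xs f)))

∑-*ˡ : (xs : List X) (f : X → ℕ) (c : ℕ) → ∑ xs (λ a → c * f a) ≡ c * ∑ xs f
∑-*ˡ xs f c = trans (∑-cong xs (λ a → *-comm c (f a))) (trans (∑-*ʳ xs f c) (*-comm (∑ xs f) c))

∑-+ : (xs : List X) (f g : X → ℕ) → ∑ xs (λ a → f a + g a) ≡ ∑ xs f + ∑ xs g
∑-+ []       f g = refl
∑-+ (a ∷ xs) f g rewrite ∑-+ xs f g = +-interchange (f a) (g a) (∑ xs f) (∑ xs g)
  where
  open import Algebra.Properties.CommutativeSemigroup +-commutativeSemigroup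
    using () renaming (interchange to +-interchange)

∑-0 : (xs : List X) → ∑ xs (λ _ → 0) ≡ 0
∑-0 []       = refl
∑-0 (_ ∷ xs) = ∑-0 xs

∑-swap : (xs : List X) (ys : List Y) (f : X → Y → ℕ) →
  ∑ xs (λ a → ∑ ys (f a)) ≡ ∑ ys (λ b → ∑ xs (λ a → f a b))
∑-swap []       ys f = sym (∑-0 ys)
∑-swap (a ∷ xs) ys f =
  trans (cong (∑ ys (f a) +_) (∑-swap xs ys f)) (sym (∑-+ ys (f a) _))

∑-++ : (xs ys : List X) (f : X → ℕ) → ∑ (xs ++ ys) f ≡ ∑ xs f + ∑ ys f
∑-++ []       ys f = refl
∑-++ (a ∷ xs) ys f = trans (cong (f a +_) (∑-++ xs ys f)) (sym (+-assoc (f a) _ _))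

∑-map : (xs : List X) (g : X → Y) (f : Y → ℕ) → ∑ (map g xs) f ≡ ∑ xs (f ∘ g)
∑-map []       g f = refl
∑-map (a ∷ xs) g f = cong (f (g a) +_) (∑-map xs g f)

∑-concatMap : (xs : List X) (g : X → List Y) (f : Y → ℕ) →
  ∑ (concatMap g xs) f ≡ ∑ xs (λ a → ∑ (g a) f)
∑-concatMap []       g f = refl
∑-concatMap (a ∷ xs) g f = trans (∑-++ (g a) _ f) (cong (∑ (g a) f +_) (∑-concatMap xs g f))

length-filter-∑ : {P : X → Set} (P? : Decidable P) (xs : List X) →
  length (filter P? xs) ≡ ∑ xs (λ a → ind (P? a))
length-filter-∑ P? []       = refl
length-filter-∑ P? (a ∷ xs) with does (P? a)
... | true  = cong suc (length-filter-∑ P? xs)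
... | false = length-filter-∑ P? xs

-- Counting colours

count : {R : Fin x → Set} → Decidable R → ℕ
count {x} R? = ∑ (allFin x) (λ a → ind (R? a))

count-size : {R : Fin x → Set} (R? : Decidable R) → count R? ≡ size (enumerate R?)
count-size {zero}  R? = refl
count-size {suc x} R? with R? zero
... | yes _ = cong suc (trans (cong sum tail) (count-size (R? ∘ suc)))
  where
  tail = trans (map-tabulate suc (λ a → ind (R? a))) (sym (map-tabulate id (λ a → ind (R? (suc a)))))
... | no _ = trans (cong sum tail) (count-size (R? ∘ suc))
  where
  tail = trans (map-tabulate suc (λ a → ind (R? a))) (sym (map-tabulate id (λ a → ind (R? (suc a)))))

-- Admissible colours and the `d` values of `g` together inject into `Fin x`; in the exact version
-- below they also cover it.
count-avoiding-≤ : {R : Fin x → Set} (R? : Decidable R) (g : Fin d → Fin x) → Inj g →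
  (∀ a i → R a → a ≢ g i) → count R? ≤ x ∸ d
count-avoiding-≤ {x} {d} R? g g-inj avoid = begin
  count R?                          ≡⟨ count-size R? ⟩
  size E                            ≡⟨ m+n∸n≡m (size E) d ⟨
  size E + d ∸ d                    ≤⟨ ∸-monoˡ-≤ d (FP.injective⇒≤ (⊕-inj (elem-inj E) g-inj λ i j → avoid _ j (sound E i))) ⟩
  x ∸ d                             ∎
  where
  open ≤-Reasoning
  E = enumerate R?

count-avoiding-≡ : {R : Fin x → Set} (R? : Decidable R) (g : Fin d → Fin x) → Inj g →
  (∀ a i → R a → a ≢ g i) → (∀ a → (∀ i → a ≢ g i) → R a) → count R? ≡ x ∸ d
count-avoiding-≡ {x} {d} R? g g-inj avoid exact = ≤-antisym (count-avoiding-≤ R? g g-inj avoid) (begin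
  x ∸ d                             ≤⟨ ∸-monoˡ-≤ d (surj⇒≥ (elem E ⊕ g) cover) ⟩
  size E + d ∸ d                    ≡⟨ m+n∸n≡m (size E) d ⟩
  size E                            ≡⟨ count-size R? ⟨
  count R?                          ∎)
  where
  open ≤-Reasoning
  E = enumerate R?
  cover : Surj (elem E ⊕ g)
  cover a with FP.any? (λ i → g i FP.≟ a)
  ... | yes (i , e) = map₂ (λ p → trans p e) (⊕-right (elem E) g i)
  ... | no miss with complete E a (exact a λ i e → miss (i , sym e))
  ... | i , e = map₂ (λ p → trans p e) (⊕-left (elem E) g i)

count-≡ : (c : Fin x) → count (FP._≟ c) ≡ 1
count-≡ {x} c = trans (count-size (FP._≟ c))
  (size-cong (enumerate (FP._≟ c)) single (λ _ e → e) (λ _ e → e))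
  where
  single : Enumeration (λ a → a ≡ c)
  single = record { size = 1 ; elem = λ _ → c ; elem-inj = λ { {zero} {zero} _ → refl }
                  ; sound = λ _ → refl ; complete = λ _ e → zero , sym e }

-- Counting functions

-- After the swap the colour of vertex `zero` is summed innermost, with the colouring of the other
-- vertices fixed.
∑-allFuns : ∀ n (ω : (Fin (suc n) → Fin x) → ℕ) →
  ∑ (allFuns (suc n) x) ω ≡ ∑ (allFuns n x) (λ f → ∑ (allFin x) (λ a → ω (a ∷ᶠ f)))
∑-allFuns {x} n ω = begin
  ∑ (allFuns (suc n) x) ω
    ≡⟨ ∑-concatMap (allFin x) _ ω ⟩
  ∑ (allFin x) (λ a → ∑ (map (λ f → a ∷ᶠ f) (allFuns n x)) ω)
    ≡⟨ ∑-cong (allFin x) (λ a → ∑-map (allFuns n x) (λ f → a ∷ᶠ f) ω) ⟩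
  ∑ (allFin x) (λ a → ∑ (allFuns n x) (λ f → ω (a ∷ᶠ f)))
    ≡⟨ ∑-swap (allFin x) (allFuns n x) _ ⟩
  ∑ (allFuns n x) (λ f → ∑ (allFin x) (λ a → ω (a ∷ᶠ f)))
    ∎
  where open ≡-Reasoning

_≗?_ : (f g : Fin n → Fin x) → Dec (f ≗ g)
f ≗? g = FP.all? (λ i → f i FP.≟ g i)

-- `allFuns` lists each function once, but only up to pointwise equality; this takes the place of
-- comparing functions in the list.
∑-≗ : ∀ n (h : Fin n → Fin x) → ∑ (allFuns n x) (λ f → ind (f ≗? h)) ≡ 1
∑-≗ zero h = refl
∑-≗ {x} (suc n) h = begin
  ∑ (allFuns (suc n) x) (λ g → ind (g ≗? h))
    ≡⟨ ∑-allFuns n _ ⟩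
  ∑ (allFuns n x) (λ f → ∑ (allFin x) (λ a → ind ((a ∷ᶠ f) ≗? h)))
    ≡⟨ ∑-cong (allFuns n x) (λ f → ∑-cong (allFin x) (λ a →
         ind-× ((a ∷ᶠ f) ≗? h) (f ≗? (h ∘ suc)) (a FP.≟ h zero)
           (λ e → e ∘ suc , e zero) (λ { e e₀ zero → e₀ ; e e₀ (suc i) → e i }))) ⟩
  ∑ (allFuns n x) (λ f → ∑ (allFin x) (λ a → ind (f ≗? (h ∘ suc)) * ind (a FP.≟ h zero)))
    ≡⟨ ∑-cong (allFuns n x) (λ f → trans (∑-*ˡ (allFin x) _ (ind (f ≗? (h ∘ suc))))
         (trans (cong (ind (f ≗? (h ∘ suc)) *_) (count-≡ (h zero))) (*-identityʳ _))) ⟩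
  ∑ (allFuns n x) (λ f → ind (f ≗? (h ∘ suc)))
    ≡⟨ ∑-≗ n (h ∘ suc) ⟩
  1 ∎
  where open ≡-Reasoning

-- Either no listed function satisfies `R`, or some `g` does, and then every other one agrees with
-- `g` pointwise.
∑-unique-≤1 : {R : (Fin n → Fin x) → Set} (R? : Decidable R) →
  (∀ f g → R f → R g → f ≗ g) → ∑ (allFuns n x) (λ f → ind (R? f)) ≤ 1
∑-unique-≤1 {n} {x} {R} R? unique with zero⊎witness (allFuns n x)
  where
  zero⊎witness : ∀ fs → ∑ fs (λ f → ind (R? f)) ≡ 0 ⊎ ∃ R
  zero⊎witness []       = inj₁ refl
  zero⊎witness (f ∷ fs) with R? f
  ... | yes r = inj₂ (f , r)
  ... | no _  = zero⊎witness fs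
... | inj₁ none    = ≤-trans (≤-reflexive none) z≤n
... | inj₂ (g , r) = ≤-trans (∑-mono (allFuns n x) below) (≤-reflexive (∑-≗ n g))
  where
  below : ∀ f → ind (R? f) ≤ ind (f ≗? g)
  below f with R? f
  ... | yes s = ≤-reflexive (sym (ind-yes (f ≗? g) (unique f g s r)))
  ... | no _  = z≤n

-- Double counting of the pairs (f , Φ f) replaces pigeonhole on the list of functions.
∑-injection : {P : (Fin n → Fin x) → Set} {Q : (Fin m → Fin x) → Set}
  (P? : Decidable P) (Q? : Decidable Q) (Φ : (Fin n → Fin x) → (Fin m → Fin x)) →
  (∀ {f g} → f ≗ g → Q f → Q g) → (∀ f → P f → Q (Φ f)) →
  (∀ f g → P f → P g → Φ f ≗ Φ g → f ≗ g) →
  ∑ (allFuns n x) (λ f → ind (P? f)) ≤ ∑ (allFuns m x) (λ g → ind (Q? g))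
∑-injection {n} {x} {m} {P} {Q} P? Q? Φ Q-resp PQ Φ-inj = begin
  ∑ Fs (λ f → ind (P? f))
    ≡⟨ ∑-cong Fs (λ f → sym (trans (cong (ind (P? f) *_) (∑-≗ m (Φ f))) (*-identityʳ _))) ⟩
  ∑ Fs (λ f → ind (P? f) * ∑ Gs (λ g → ind (g ≗? Φ f)))
    ≡⟨ ∑-cong Fs (λ f → sym (∑-*ˡ Gs _ (ind (P? f)))) ⟩
  ∑ Fs (λ f → ∑ Gs (λ g → ind (P? f) * ind (g ≗? Φ f)))
    ≡⟨ ∑-swap Fs Gs _ ⟩
  ∑ Gs (λ g → ∑ Fs (λ f → ind (P? f) * ind (g ≗? Φ f)))
    ≤⟨ ∑-mono Gs fibre ⟩
  ∑ Gs (λ g → ind (Q? g)) ∎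
  where
  open ≤-Reasoning
  Fs = allFuns n x
  Gs = allFuns m x
  both? : ∀ g → Decidable (λ f → P f × (g ≗ Φ f))
  both? g f = P? f ×-dec (g ≗? Φ f)
  collect : ∀ g → ∑ Fs (λ f → ind (P? f) * ind (g ≗? Φ f)) ≡ ∑ Fs (λ f → ind (both? g f))
  collect g = ∑-cong Fs λ f → sym (ind-× (both? g f) (P? f) (g ≗? Φ f) id _,_)
  fibre : ∀ g → ∑ Fs (λ f → ind (P? f) * ind (g ≗? Φ f)) ≤ ind (Q? g)
  fibre g with Q? g
  ... | yes _ = ≤-trans (≤-reflexive (collect g)) (∑-unique-≤1 (both? g)
          λ f f′ (p , e) (p′ , e′) → Φ-inj f f′ p p′ λ i → trans (sym (e i)) (e′ i))
  ... | no ¬q = ≤-reflexive (trans (collect g) (trans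
          (∑-cong Fs λ f → ind-no (both? g f) λ (p , e) → ¬q (Q-resp (λ i → sym (e i)) (PQ f p)))
          (∑-0 Fs)))

-- Chromatic polynomials, one vertex at a time

infix 9 _[_]
-- `σ` is an ordered vertex list whose head is removed first. Any map is allowed; along a surjective
-- one a colouring is determined by its values, so passing to the pullback cannot lower the count.
_[_] : Graph n → (Fin m → Fin n) → Graph m
G [ σ ] = record
  { adj     = λ i j → adj G (σ i) (σ j)
  ; adj-sym = λ i j → adj-sym G (σ i) (σ j)
  ; irrefl  = λ i → irrefl G (σ i) }

Adj-sym : (G : Graph n) {u v : Fin n} → Adj G u v → Adj G v u
Adj-sym G {u} {v} e = trans (adj-sym G v u) e

Adj-irrefl : (G : Graph n) {u v : Fin n} → Adj G u v → u ≢ v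
Adj-irrefl G {u} e refl with trans (sym (irrefl G u)) e
... | ()

Adj? : (G : Graph n) (u v : Fin n) → Dec (Adj G u v)
Adj? G u v = adj G u v Data.Bool.≟ true

IsClique : Graph n → (Fin m → Fin n) → Set
IsClique G κ = ∀ i j → i ≢ j → Adj G (κ i) (κ j)

Clique : Graph n → ℕ → Set
Clique {n} G m = Σ (Fin m → Fin n) (IsClique G)

clique-inj : (G : Graph n) {κ : Fin m → Fin n} → IsClique G κ → Inj κ
clique-inj G clq {i} {j} e with i FP.≟ j
... | yes i≡j = i≡j
... | no i≢j  = ⊥-elim (Adj-irrefl G (clq i j i≢j) e)

∷-clique : (G : Graph n) {κ : Fin m → Fin n} {v : Fin n} → IsClique G κ →
  (∀ i → Adj G v (κ i)) → IsClique G (v ∷ᶠ κ)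
∷-clique G clq v~ zero    zero    i≢j = ⊥-elim (i≢j refl)
∷-clique G clq v~ zero    (suc j) i≢j = v~ j
∷-clique G clq v~ (suc i) zero    i≢j = Adj-sym G (v~ i)
∷-clique G clq v~ (suc i) (suc j) i≢j = clq i j (i≢j ∘ cong suc)

[]-clique : (G : Graph n) → IsClique G []ᶠ
[]-clique G ()

colours-inj : (G : Graph n) {κ : Fin m → Fin n} {f : Fin n → Fin x} →
  IsClique G κ → Proper G f → Inj (f ∘ κ)
colours-inj G {κ} clq f-proper {i} {j} e with i FP.≟ j
... | yes i≡j = i≡j
... | no i≢j  = ⊥-elim (f-proper (κ i) (κ j) (clq i j i≢j) e)

Free : Graph (suc n) → (Fin n → Fin x) → Fin x → Set
Free G f a = ∀ j → Adj G zero (suc j) → a ≢ f j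

free? : (G : Graph (suc n)) (f : Fin n → Fin x) → Decidable (Free G f)
free? G f a = FP.all? λ j → Adj? G zero (suc j) →-dec ¬? (a FP.≟ f j)

ind-proper-∷ : (G : Graph (suc n)) (a : Fin x) (f : Fin n → Fin x) →
  ind (proper? G (a ∷ᶠ f)) ≡ ind (proper? (G [ suc ]) f) * ind (free? G f a)
ind-proper-∷ G a f = ind-× (proper? G (a ∷ᶠ f)) (proper? (G [ suc ]) f) (free? G f a)
  (λ pr → (λ u v → pr (suc u) (suc v)) , (λ j → pr zero (suc j)))
  λ { pr fr zero    zero    e → ⊥-elim (Adj-irrefl G e refl)
    ; pr fr zero    (suc j) e → fr j e
    ; pr fr (suc i) zero    e → fr i (Adj-sym G e) ∘ sym
    ; pr fr (suc i) (suc j) e → pr i j e }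

-- The weight `ω` covers the situation where the number of choices for one further vertex still
-- depends on the colour of this one, as in `chromPoly-ear₂`.
∑-proper-suc : (G : Graph (suc n)) (ω : (Fin (suc n) → Fin x) → ℕ) →
  ∑ (allFuns (suc n) x) (λ g → ind (proper? G g) * ω g) ≡
  ∑ (allFuns n x) (λ f → ind (proper? (G [ suc ]) f) *
    ∑ (allFin x) (λ a → ind (free? G f a) * ω (a ∷ᶠ f)))
∑-proper-suc {n} {x} G ω = trans (∑-allFuns n _) (∑-cong (allFuns n x) λ f →
  trans (∑-cong (allFin x) λ a →
           trans (cong (_* ω (a ∷ᶠ f)) (ind-proper-∷ G a f)) (*-assoc (ind (proper? (G [ suc ]) f)) _ _))
        (∑-*ˡ (allFin x) _ (ind (proper? (G [ suc ]) f))))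

chromPoly-∑ : (G : Graph n) (x : ℕ) → chromPoly G x ≡ ∑ (allFuns n x) (λ f → ind (proper? G f))
chromPoly-∑ {n} G x = length-filter-∑ (proper? G) (allFuns n x)

chromPoly-suc : (G : Graph (suc n)) (x : ℕ) → chromPoly G x ≡
  ∑ (allFuns n x) (λ f → ind (proper? (G [ suc ]) f) * count (free? G f))
chromPoly-suc {n} G x = begin
  chromPoly G x
    ≡⟨ chromPoly-∑ G x ⟩
  ∑ (allFuns (suc n) x) (λ g → ind (proper? G g))
    ≡⟨ ∑-cong (allFuns (suc n) x) (λ g → sym (*-identityʳ _)) ⟩
  ∑ (allFuns (suc n) x) (λ g → ind (proper? G g) * 1)
    ≡⟨ ∑-proper-suc G (λ _ → 1) ⟩
  ∑ (allFuns n x) (λ f → ind (proper? (G [ suc ]) f) * ∑ (allFin x) (λ a → ind (free? G f a) * 1))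
    ≡⟨ ∑-cong (allFuns n x) (λ f → cong (ind (proper? (G [ suc ]) f) *_)
         (∑-cong (allFin x) λ a → *-identityʳ _)) ⟩
  ∑ (allFuns n x) (λ f → ind (proper? (G [ suc ]) f) * count (free? G f)) ∎
  where open ≡-Reasoning

ind-*-≡ : {P : Set} (P? : Dec P) {w : ℕ} → (P → w ≡ d) → ind P? * w ≡ d * ind P?
ind-*-≡ {d} (yes p) {w} w≡d = trans (+-identityʳ w) (trans (w≡d p) (sym (*-identityʳ d)))
ind-*-≡ {d} (no _)      w≡d = sym (*-zeroʳ d)

ind-*-≤ : {P : Set} (P? : Dec P) {w : ℕ} → (P → w ≤ d) → ind P? * w ≤ d * ind P?
ind-*-≤ {d} (yes p) {w} w≤d =
  subst₂ _≤_ (sym (+-identityʳ w)) (sym (*-identityʳ d)) (w≤d p)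
ind-*-≤     (no _)      w≤d = z≤n

∑-proper-const : (G : Graph n) (w : (Fin n → Fin x) → ℕ) → (∀ f → Proper G f → w f ≡ d) →
  ∑ (allFuns n x) (λ f → ind (proper? G f) * w f) ≡ d * chromPoly G x
∑-proper-const {n} {x} {d} G w w≡d = trans (∑-cong (allFuns n x) λ f → ind-*-≡ (proper? G f) (w≡d f))
  (trans (∑-*ˡ (allFuns n x) _ d) (cong (d *_) (sym (chromPoly-∑ G x))))

∑-proper-≤ : (G : Graph n) (w : (Fin n → Fin x) → ℕ) → (∀ f → Proper G f → w f ≤ d) →
  ∑ (allFuns n x) (λ f → ind (proper? G f) * w f) ≤ d * chromPoly G x
∑-proper-≤ {n} {x} {d} G w w≤d = ≤-trans (∑-mono (allFuns n x) λ f → ind-*-≤ (proper? G f) (w≤d f))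
  (≤-reflexive (trans (∑-*ˡ (allFuns n x) _ d) (cong (d *_) (sym (chromPoly-∑ G x)))))

count-free-≤ : (G : Graph (suc n)) (ι : Fin d → Fin n) → IsClique (G [ suc ]) ι →
  (∀ i → Adj G zero (suc (ι i))) → (f : Fin n → Fin x) → Proper (G [ suc ]) f →
  count (free? G f) ≤ x ∸ d
count-free-≤ G ι clq 0~ι f pr = count-avoiding-≤ (free? G f) (f ∘ ι) (colours-inj (G [ suc ]) clq pr)
  λ a i fr → fr (ι i) (0~ι i)

count-free-≡ : (G : Graph (suc n)) (ι : Fin d → Fin n) (f : Fin n → Fin x) → Inj (f ∘ ι) →
  (∀ i → Adj G zero (suc (ι i))) → (∀ j → Adj G zero (suc j) → ∃ λ i → ι i ≡ j) →
  count (free? G f) ≡ x ∸ d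
count-free-≡ G ι f inj 0~ι only = count-avoiding-≡ (free? G f) (f ∘ ι) inj
  (λ a i fr → fr (ι i) (0~ι i))
  λ a avoid j 0~j e → let i , ιi≡j = only j 0~j in avoid i (trans e (cong f (sym ιi≡j)))

-- The `d` clique neighbours get distinct colours, all forbidden at vertex `zero`.
chromPoly-suc-≤ : (G : Graph (suc n)) (x : ℕ) (ι : Fin d → Fin n) → IsClique (G [ suc ]) ι →
  (∀ i → Adj G zero (suc (ι i))) → chromPoly G x ≤ (x ∸ d) * chromPoly (G [ suc ]) x
chromPoly-suc-≤ G x ι clq 0~ι = ≤-trans (≤-reflexive (chromPoly-suc G x))
  (∑-proper-≤ (G [ suc ]) _ (count-free-≤ G ι clq 0~ι))

chromPoly-suc-≡ : (G : Graph (suc n)) (x : ℕ) (ι : Fin d → Fin n) → IsClique (G [ suc ]) ι →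
  (∀ i → Adj G zero (suc (ι i))) → (∀ j → Adj G zero (suc j) → ∃ λ i → ι i ≡ j) →
  chromPoly G x ≡ (x ∸ d) * chromPoly (G [ suc ]) x
chromPoly-suc-≡ G x ι clq 0~ι only = trans (chromPoly-suc G x)
  (∑-proper-const (G [ suc ]) _ λ f pr →
    count-free-≡ G ι f (colours-inj (G [ suc ]) clq pr) 0~ι only)

-- Peels off the last factor, the number of colours left for one more clique vertex; the definition
-- peels off the first.
falling-suc : ∀ x m → falling x (suc m) ≡ (x ∸ m) * falling x m
falling-suc x zero    = refl
falling-suc x (suc m) = begin
  x * falling (x ∸ 1) (suc m)                ≡⟨ cong (x *_) (falling-suc (x ∸ 1) m) ⟩
  x * ((x ∸ 1 ∸ m) * falling (x ∸ 1) m)      ≡⟨ *-left-comm x (x ∸ 1 ∸ m) _ ⟩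
  (x ∸ 1 ∸ m) * falling x (suc m)            ≡⟨ cong (_* falling x (suc m)) (∸-+-assoc x 1 m) ⟩
  (x ∸ suc m) * falling x (suc m)            ∎
  where
  open ≡-Reasoning
  open import Algebra.Properties.CommutativeSemigroup *-commutativeSemigroup
    using () renaming (x∙yz≈y∙xz to *-left-comm)

chromPoly-complete : (G : Graph m) (x : ℕ) → IsClique G id → chromPoly G x ≡ falling x m
chromPoly-complete {zero}  G x clq = refl
chromPoly-complete {suc m} G x clq = begin
  chromPoly G x                      ≡⟨ chromPoly-suc-≡ G x id tail (λ i → clq zero (suc i) (λ ())) (λ j _ → j , refl) ⟩
  (x ∸ m) * chromPoly (G [ suc ]) x  ≡⟨ cong ((x ∸ m) *_) (chromPoly-complete (G [ suc ]) x tail) ⟩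
  (x ∸ m) * falling x m              ≡⟨ falling-suc x m ⟨
  falling x (suc m)                  ∎
  where
  open ≡-Reasoning
  tail : IsClique (G [ suc ]) id
  tail i j i≢j = clq (suc i) (suc j) (i≢j ∘ FP.suc-injective)

-- Comparing chromatic polynomials along maps of vertices

Proper-resp : (G : Graph n) {f g : Fin n → Fin x} → f ≗ g → Proper G f → Proper G g
Proper-resp G f≗g pr u v e gu≡gv = pr u v e (trans (f≗g u) (trans gu≡gv (sym (f≗g v))))

-- `σ` may omit vertices whose colours `P` allows to be recovered, which is how `v` is dropped when
-- `c u ≡ c v`. Likewise `H` may have edges that are properly coloured only thanks to `P`.
chromPoly-injection : {P : (Fin n → Fin x) → Set} (P? : Decidable P) (H : Graph m)
  (σ : Fin m → Fin n) → (∀ f → P f → Proper H (f ∘ σ)) →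
  (∀ f g → P f → P g → f ∘ σ ≗ g ∘ σ → f ≗ g) →
  ∑ (allFuns n x) (λ f → ind (P? f)) ≤ chromPoly H x
chromPoly-injection {x = x} P? H σ proper σ-inj = ≤-trans
  (∑-injection P? (proper? H) (_∘ σ) (Proper-resp H) proper σ-inj)
  (≤-reflexive (sym (chromPoly-∑ H x)))

infix 4 _∈ᶠ_
_∈ᶠ_ : X → (Fin m → X) → Set
v ∈ᶠ σ = ∃ λ i → σ i ≡ v

chromPoly-cover : (G : Graph n) (x : ℕ) (σ : Fin m → Fin n) → Surj σ → chromPoly G x ≤ chromPoly (G [ σ ]) x
chromPoly-cover G x σ σ-surj = ≤-trans (≤-reflexive (chromPoly-∑ G x))
  (chromPoly-injection (proper? G) (G [ σ ]) σ (λ f pr u v → pr (σ u) (σ v))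
    λ f g _ _ e v → let i , σi≡v = σ-surj v in subst (λ w → f w ≡ g w) σi≡v (e i))

module _ (G : Graph n) (x : ℕ) where

  step₁ : (σ : Fin m → Fin n) {v p : Fin n} → p ∈ᶠ σ → Adj G v p →
    chromPoly (G [ v ∷ᶠ σ ]) x ≤ (x ∸ 1) * chromPoly (G [ σ ]) x
  step₁ σ (i , refl) v~p = chromPoly-suc-≤ (G [ _ ∷ᶠ σ ]) x (i ∷ᶠ []ᶠ)
    (∷-clique (G [ σ ]) ([]-clique (G [ σ ])) (λ ())) λ { zero → v~p }

  step₂ : (σ : Fin m → Fin n) {v p q : Fin n} → p ∈ᶠ σ → q ∈ᶠ σ → Adj G p q →
    Adj G v p → Adj G v q →
    chromPoly (G [ v ∷ᶠ σ ]) x ≤ (x ∸ 2) * chromPoly (G [ σ ]) x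
  step₂ σ (i , refl) (j , refl) p~q v~p v~q = chromPoly-suc-≤ (G [ _ ∷ᶠ σ ]) x (i ∷ᶠ j ∷ᶠ []ᶠ)
    (∷-clique (G [ σ ]) (∷-clique (G [ σ ]) ([]-clique (G [ σ ])) λ ()) λ { zero → p~q })
    λ { zero → v~p ; (suc zero) → v~q }

  -- A single edge `p q` of the base closes a triangle with every vertex of `τ`.
  steps₂ : (τ : Fin t → Fin n) (σ : Fin m → Fin n) {p q : Fin n} → p ∈ᶠ σ → q ∈ᶠ σ → Adj G p q →
    (∀ i → Adj G (τ i) p) → (∀ i → Adj G (τ i) q) →
    chromPoly (G [ τ ⊕ σ ]) x ≤ (x ∸ 2) ^ℕ t * chromPoly (G [ σ ]) x
  steps₂ {t = zero} τ σ p∈ q∈ p~q τ~p τ~q = ≤-reflexive (sym (+-identityʳ _))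
  steps₂ {t = suc t} τ σ p∈ q∈ p~q τ~p τ~q = begin
    chromPoly (G [ τ ⊕ σ ]) x
      ≤⟨ step₂ ((τ ∘ suc) ⊕ σ) (lift p∈) (lift q∈) p~q (τ~p zero) (τ~q zero) ⟩
    (x ∸ 2) * chromPoly (G [ (τ ∘ suc) ⊕ σ ]) x
      ≤⟨ *-monoʳ-≤ (x ∸ 2) (steps₂ (τ ∘ suc) σ p∈ q∈ p~q (τ~p ∘ suc) (τ~q ∘ suc)) ⟩
    (x ∸ 2) * ((x ∸ 2) ^ℕ t * chromPoly (G [ σ ]) x)
      ≡⟨ *-assoc (x ∸ 2) _ _ ⟨
    (x ∸ 2) ^ℕ suc t * chromPoly (G [ σ ]) x ∎
    where
    open ≤-Reasoning
    lift : ∀ {v} → v ∈ᶠ σ → v ∈ᶠ ((τ ∘ suc) ⊕ σ)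
    lift (i , e) = map₂ (λ p → trans p e) (⊕-right (τ ∘ suc) σ i)

-- Isomorphisms

≅-inj : (G : Graph n) (H : Graph m) (σ : Fin n → Fin m) → n ≡ m → Inj σ →
  (∀ u v → adj G u v ≡ adj H (σ u) (σ v)) → G ≅ H
≅-inj G H σ refl σ-inj adj≡ =
  mk↔ₛ′ σ (λ v → proj₁ (σ-surj v)) (λ v → proj₂ (σ-surj v)) (λ u → σ-inj (proj₂ (σ-surj (σ u)))) , adj≡
  where σ-surj = inj⇒surj σ σ-inj

≅-sym : (G : Graph n) (H : Graph m) → G ≅ H → H ≅ G
≅-sym G H (f , adj≡) = mk↔ₛ′ from to strictlyInverseʳ strictlyInverseˡ ,
  λ u v → trans (cong₂ (adj H) (sym (strictlyInverseˡ u)) (sym (strictlyInverseˡ v))) (sym (adj≡ (from u) (from v)))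
  where open Inverse f using (to; from; strictlyInverseˡ; strictlyInverseʳ)

≅-trans : ∀ {l} (G : Graph n) (H : Graph m) (K : Graph l) → G ≅ H → H ≅ K → G ≅ K
≅-trans G H K (f , e) (g , e′) = g ↔-∘ f , λ u v → trans (e u v) (e′ _ _)

chromPoly-≅-≤ : (G : Graph n) (H : Graph m) (x : ℕ) → G ≅ H → chromPoly H x ≤ chromPoly G x
chromPoly-≅-≤ G H x (f , adj≡) = ≤-trans (≤-reflexive (chromPoly-∑ H x))
  (chromPoly-injection (proper? H) G to
    (λ c pr u v e → pr (to u) (to v) (trans (sym (adj≡ u v)) e))
    λ c d _ _ e v → subst (λ w → c w ≡ d w) (strictlyInverseˡ v) (e (from v)))
  where open Inverse f using (to; from; strictlyInverseˡ)

chromPoly-≅ : (G : Graph n) (H : Graph m) (x : ℕ) → G ≅ H → chromPoly G x ≡ chromPoly H x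
chromPoly-≅ G H x G≅H = ≤-antisym (chromPoly-≅-≤ H G x (≅-sym G H G≅H)) (chromPoly-≅-≤ G H x G≅H)

-- The bound without signs

-- (x)ₖ · pathFactor x l counts the colourings of G_{k+l,k}.
pathFactor : ℕ → ℕ → ℕ
pathFactor x zero          = 1
pathFactor x (suc zero)    = x ∸ 2
pathFactor x (suc (suc l)) = (x ∸ 2) * (x ∸ 1) ^ℕ suc l + pathFactor x l

pathFactor-pos : ∀ x l → 3 ≤ x → 0 < pathFactor x l
pathFactor-pos x zero          3≤x = z<s
pathFactor-pos x (suc zero)    3≤x = ∸-monoˡ-≤ 2 3≤x
pathFactor-pos x (suc (suc l)) 3≤x = <-≤-trans (pathFactor-pos x l 3≤x) (m≤n+m _ _)

pathFactor-> : ∀ x l → 3 ≤ x → (x ∸ 2) * (x ∸ 1) ^ℕ suc l < pathFactor x (suc (suc l))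
pathFactor-> x l 3≤x = subst (_≤ pathFactor x (suc (suc l))) (+-comm _ 1)
  (+-monoʳ-≤ ((x ∸ 2) * (x ∸ 1) ^ℕ suc l) (pathFactor-pos x l 3≤x))

falling-pos : ∀ x k → k ≤ x → 0 < falling x k
falling-pos x       zero    k≤x       = z<s
falling-pos (suc x) (suc k) (s≤s k≤x) = *-mono-< {0} {suc x} {0} z<s (falling-pos x k k≤x)

-- Strictness comes from the summand `pathFactor x l`, positive for x ≥ 3, which the estimate of `p`
-- leaves out.
below-bound : ∀ x k l {p} → 3 ≤ x → k ≤ x → p ≤ (x ∸ 2) * (x ∸ 1) ^ℕ suc l * falling x k →
  p < falling x k * pathFactor x (suc (suc l))
below-bound x k l 3≤x k≤x p≤ = ≤-<-trans p≤ (subst (_< falling x k * pathFactor x (suc (suc l)))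
  (*-comm (falling x k) ((x ∸ 2) * (x ∸ 1) ^ℕ suc l))
  (*-monoʳ-< (falling x k) {{>-nonZero (falling-pos x k k≤x)}} (pathFactor-> x l 3≤x)))

-- A clique with an ear of one or two vertices

completeGraph : ∀ n → Graph n
completeGraph n = record
  { adj     = λ i j → not (does (i FP.≟ j))
  ; adj-sym = λ i j → cong not (does-sym i j)
  ; irrefl  = λ i → cong not (dec-true (i FP.≟ i) refl) }
  where
  does-sym : ∀ i j → does (i FP.≟ j) ≡ does (j FP.≟ i)
  does-sym i j with i FP.≟ j
  ... | yes p = sym (dec-true (j FP.≟ i) (sym p))
  ... | no ¬p = sym (dec-false (j FP.≟ i) (¬p ∘ sym))

infixr 5 _◃_
-- `(N ◃ G) [ suc ]` has the adjacency of `G` by computation, so colourings of the models below are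
-- counted one vertex at a time; `Gmk` is reached only through isomorphisms.
_◃_ : (Fin n → Bool) → Graph n → Graph (suc n)
N ◃ G = record
  { adj     = λ { zero zero → false ; zero (suc j) → N j ; (suc i) zero → N i ; (suc i) (suc j) → adj G i j }
  ; adj-sym = λ { zero zero → refl ; zero (suc j) → refl ; (suc i) zero → refl ; (suc i) (suc j) → adj-sym G i j }
  ; irrefl  = λ { zero → refl ; (suc i) → irrefl G i } }

complete-clique : ∀ n → IsClique (completeGraph n) id
complete-clique n i j i≢j = cong not (dec-false (i FP.≟ j) i≢j)

Preserves : Graph m → Graph n → (Fin m → Fin n) → Set
Preserves H G σ = ∀ i j → adj H i j ≡ adj G (σ i) (σ j)

clique-preserves : (G : Graph n) {κ : Fin m → Fin n} → IsClique G κ → Preserves (completeGraph m) G κ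
clique-preserves G {κ} clq i j with i FP.≟ j
... | yes refl = sym (irrefl G (κ i))
... | no i≢j   = sym (clq i j i≢j)

◃-preserves : {H : Graph m} (G : Graph n) {σ : Fin m → Fin n} {w : Fin n} {N : Fin m → Bool} →
  Preserves H G σ → (∀ j → N j ≡ adj G w (σ j)) → Preserves (N ◃ H) G (w ∷ᶠ σ)
◃-preserves G {w = w} p q zero    zero    = sym (irrefl G w)
◃-preserves G {w = w} p q zero    (suc j) = q j
◃-preserves G {σ} {w} p q (suc i) zero    = trans (q i) (adj-sym G w (σ i))
◃-preserves G         p q (suc i) (suc j) = p i j

firstTwo : Fin (2 + r) → Bool
firstTwo zero          = true
firstTwo (suc zero)    = true
firstTwo (suc (suc _)) = false

first : Fin (2 + r) → Bool
first zero    = true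
first (suc _) = false

second : Fin (2 + r) → Bool
second zero          = false
second (suc zero)    = true
second (suc (suc _)) = false

ear₁ : ∀ r → Graph (1 + (2 + r))
ear₁ r = firstTwo ◃ completeGraph (2 + r)

-- Vertex 0 is the ear vertex at the second clique vertex; its `true` is the edge to vertex 1, which
-- hangs on the first clique vertex.
ear₂ : ∀ r → Graph (2 + (2 + r))
ear₂ r = (true ∷ᶠ second) ◃ first ◃ completeGraph (2 + r)

-- Used twice, for the graph of the theorem and for `Gmk` itself; the two isomorphisms are then
-- composed.
ear₁-≅ : (G : Graph n) (κ : Fin (2 + r) → Fin n) (w : Fin n) → 1 + (2 + r) ≡ n →
  IsClique G κ → (∀ i → w ≢ κ i) → (∀ j → firstTwo j ≡ adj G w (κ j)) → ear₁ r ≅ G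
ear₁-≅ G κ w size clq w∉ N = ≅-inj (ear₁ _) G (w ∷ᶠ κ) size
  (∷-inj (clique-inj G clq) w∉) (◃-preserves G (clique-preserves G clq) N)

ear₂-≅ : (G : Graph n) (κ : Fin (2 + r) → Fin n) (w w′ : Fin n) → 2 + (2 + r) ≡ n →
  IsClique G κ → (∀ i → w ≢ κ i) → (∀ i → w′ ≢ κ i) → Adj G w′ w →
  (∀ j → first j ≡ adj G w (κ j)) → (∀ j → second j ≡ adj G w′ (κ j)) → ear₂ r ≅ G
ear₂-≅ G κ w w′ size clq w∉ w′∉ w′~w N N′ = ≅-inj (ear₂ _) G (w′ ∷ᶠ w ∷ᶠ κ) size
  (∷-inj (∷-inj (clique-inj G clq) w∉) λ { zero → Adj-irrefl G w′~w ; (suc i) → w′∉ i })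
  (◃-preserves G (◃-preserves G (clique-preserves G clq) N) λ { zero → sym w′~w ; (suc j) → N′ j })

chromPoly-ear₁ : ∀ r x → chromPoly (ear₁ r) x ≡ falling x (2 + r) * pathFactor x 1
chromPoly-ear₁ r x = trans
  (chromPoly-suc-≡ (ear₁ r) x ι (λ i j i≢j → complete-clique (2 + r) (ι i) (ι j) (i≢j ∘ ι-inj))
    (λ { zero → refl ; (suc zero) → refl }) (λ { zero _ → zero , refl ; (suc zero) _ → suc zero , refl }))
  (trans (cong ((x ∸ 2) *_) (chromPoly-complete (ear₁ r [ suc ]) x (complete-clique (2 + r)))) (*-comm (x ∸ 2) _))
  where
  ι : Fin 2 → Fin (2 + r)
  ι = zero ∷ᶠ suc zero ∷ᶠ []ᶠ
  ι-inj : Inj ι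
  ι-inj {zero}     {zero}     e = refl
  ι-inj {zero}     {suc zero} ()
  ι-inj {suc zero} {zero}     ()
  ι-inj {suc zero} {suc zero} e = refl

-- Fix a colouring `f` of the clique. The ear vertex at `zero` has x - 1 colours `a`. The other one
-- avoids `a` and `f two`, leaving x - 2 colours, and one more when these coincide, which happens
-- for a single `a`. The total is (x - 1)(x - 2) + 1.
chromPoly-ear₂ : ∀ r x → 2 ≤ x → chromPoly (ear₂ r) x ≡ falling x (2 + r) * pathFactor x 2
chromPoly-ear₂ r x 2≤x = begin
  chromPoly H x
    ≡⟨ chromPoly-suc H x ⟩
  ∑ (allFuns (3 + r) x) (λ g → ind (proper? (H [ suc ]) g) * count (free? H g))
    ≡⟨ ∑-proper-suc {x = x} (H [ suc ]) (λ g → count (free? H g)) ⟩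
  ∑ (allFuns (2 + r) x) (λ f → ind (proper? K f) *
    ∑ (allFin x) (λ a → ind (free? (H [ suc ]) f a) * count (free? H (a ∷ᶠ f))))
    ≡⟨ ∑-proper-const K _ extensions ⟩
  pathFactor x 2 * chromPoly K x
    ≡⟨ cong (pathFactor x 2 *_) (chromPoly-complete K x (complete-clique (2 + r))) ⟩
  pathFactor x 2 * falling x (2 + r)
    ≡⟨ *-comm (pathFactor x 2) _ ⟩
  falling x (2 + r) * pathFactor x 2 ∎
  where
  open ≡-Reasoning
  H = ear₂ r
  K = H [ suc ] [ suc ]
  two : Fin (2 + r)
  two = suc zero
  last-count : ∀ a (f : Fin (2 + r) → Fin x) →
    count (free? H (a ∷ᶠ f)) ≡ (x ∸ 2) + ind (a FP.≟ f two)
  last-count a f with a FP.≟ f two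
  ... | yes a≡ = trans
    (count-avoiding-≡ (free? H (a ∷ᶠ f)) (a ∷ᶠ []ᶠ) (λ { {zero} {zero} _ → refl })
      (λ { b zero fr → fr zero refl })
      λ { b av zero _ → av zero ; b av (suc (suc zero)) _ e → av zero (trans e (sym a≡)) })
    (lemma 2≤x)
    where
    lemma : ∀ {x} → 2 ≤ x → x ∸ 1 ≡ (x ∸ 2) + 1
    lemma (s≤s (s≤s {n = z} _)) = +-comm 1 z
  ... | no a≢ = trans
    (count-free-≡ H (zero ∷ᶠ suc two ∷ᶠ []ᶠ) (a ∷ᶠ f)
      distinct
      (λ { zero → refl ; (suc zero) → refl })
      λ { zero _ → zero , refl ; (suc (suc zero)) _ → suc zero , refl })
    (sym (+-identityʳ (x ∸ 2)))
    where
    distinct : Inj ((a ∷ᶠ f) ∘ (zero ∷ᶠ suc two ∷ᶠ []ᶠ))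
    distinct {zero}     {zero}     e = refl
    distinct {zero}     {suc zero} e = ⊥-elim (a≢ e)
    distinct {suc zero} {zero}     e = ⊥-elim (a≢ (sym e))
    distinct {suc zero} {suc zero} e = refl
  extensions : ∀ f → Proper K f →
    ∑ (allFin x) (λ a → ind (free? (H [ suc ]) f a) * count (free? H (a ∷ᶠ f))) ≡ pathFactor x 2
  extensions f pr = begin
    ∑ (allFin x) (λ a → ind (free? F f a) * count (free? H (a ∷ᶠ f)))
      ≡⟨ ∑-cong (allFin x) (λ a → trans (cong (ind (free? F f a) *_) (last-count a f))
           (trans (*-distribˡ-+ (ind (free? F f a)) (x ∸ 2) _) (cong₂ _+_ refl (absorb a)))) ⟩
    ∑ (allFin x) (λ a → ind (free? F f a) * (x ∸ 2) + ind (a FP.≟ f two))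
      ≡⟨ ∑-+ (allFin x) _ _ ⟩
    ∑ (allFin x) (λ a → ind (free? F f a) * (x ∸ 2)) + count (FP._≟ f two)
      ≡⟨ cong₂ _+_ (∑-*ʳ (allFin x) _ (x ∸ 2)) (count-≡ (f two)) ⟩
    count (free? F f) * (x ∸ 2) + 1
      ≡⟨ cong (λ c → c * (x ∸ 2) + 1) (count-free-≡ F (zero ∷ᶠ []ᶠ) f (λ { {zero} {zero} _ → refl })
           (λ { zero → refl }) λ { zero _ → zero , refl }) ⟩
    (x ∸ 1) * (x ∸ 2) + 1
      ≡⟨ cong (_+ 1) (*-comm (x ∸ 1) (x ∸ 2)) ⟩
    (x ∸ 2) * (x ∸ 1) + 1
      ≡⟨ cong (λ e → (x ∸ 2) * e + 1) (sym (*-identityʳ (x ∸ 1))) ⟩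
    (x ∸ 2) * (x ∸ 1) ^ℕ 1 + 1 ∎
    where
    F = H [ suc ]
    -- The colour `f two` is free for the ear vertex at `zero` because the first two clique vertices
    -- differ, so the extra choice does occur.
    absorb : ∀ a → ind (free? F f a) * ind (a FP.≟ f two) ≡ ind (a FP.≟ f two)
    absorb a = sym (ind-× (a FP.≟ f two) (free? F f a) (a FP.≟ f two)
      (λ e → (λ { zero _ e′ → pr (suc zero) zero refl (trans (sym e) e′) }) , e) (λ _ e → e))

-- The graphs G_{k+1,k} and G_{k+2,k}

data GEdge (m k i j : ℕ) : Set where
  clique   : i < k → j < k → GEdge m k i j
  internal : k ≤ i → j ≡ suc i → j < m → GEdge m k i j
  start    : k < m → i ≡ 0 → j ≡ k → GEdge m k i j
  end      : k < m → i ≡ 1 → suc j ≡ m → GEdge m k i j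

T-∨⁻ : ∀ {a b} → T (a ∨ b) → T a ⊎ T b
T-∨⁻ = Equivalence.to T-∨

T-∧⁻ : ∀ {a b} → T (a ∧ b) → T a × T b
T-∧⁻ = Equivalence.to T-∧

gEdge⇒ : ∀ m k i j → T (gEdge m k i j) → GEdge m k i j
gEdge⇒ m k i j e with T-∨⁻ {(i <ᵇ k) ∧ (j <ᵇ k)} e
... | inj₁ p = let a , b = T-∧⁻ {i <ᵇ k} p in clique (<ᵇ⇒< i k a) (<ᵇ⇒< j k b)
... | inj₂ e with T-∨⁻ {(k ≤ᵇ i) ∧ (j ≡ᵇ suc i) ∧ (j <ᵇ m)} e
... | inj₁ p = let a , bc = T-∧⁻ {k ≤ᵇ i} p ; b , c = T-∧⁻ {j ≡ᵇ suc i} bc in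
               internal (≤ᵇ⇒≤ k i a) (≡ᵇ⇒≡ j (suc i) b) (<ᵇ⇒< j m c)
... | inj₂ e with T-∨⁻ {(k <ᵇ m) ∧ (i ≡ᵇ 0) ∧ (j ≡ᵇ k)} e
... | inj₁ p = let a , bc = T-∧⁻ {k <ᵇ m} p ; b , c = T-∧⁻ {i ≡ᵇ 0} bc in
               start (<ᵇ⇒< k m a) (≡ᵇ⇒≡ i 0 b) (≡ᵇ⇒≡ j k c)
... | inj₂ p = let a , bc = T-∧⁻ {k <ᵇ m} p ; b , c = T-∧⁻ {i ≡ᵇ 1} bc in
               end (<ᵇ⇒< k m a) (≡ᵇ⇒≡ i 1 b) (≡ᵇ⇒≡ (suc j) m c)

T-∨ʳ : ∀ a {b} → T b → T (a ∨ b)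
T-∨ʳ a = Equivalence.from (T-∨ {a}) ∘ inj₂

T-∨ˡ : ∀ {a b} → T a → T (a ∨ b)
T-∨ˡ = Equivalence.from T-∨ ∘ inj₁

T-∧⁺ : ∀ {a b} → T a → T b → T (a ∧ b)
T-∧⁺ a b = Equivalence.from T-∧ (a , b)

gEdge⇐ : ∀ m k i j → GEdge m k i j → T (gEdge m k i j)
gEdge⇐ m k i j (clique p q) = T-∨ˡ (T-∧⁺ (<⇒<ᵇ p) (<⇒<ᵇ q))
gEdge⇐ m k i j (internal p q r) = T-∨ʳ ((i <ᵇ k) ∧ (j <ᵇ k))
  (T-∨ˡ (T-∧⁺ (≤⇒≤ᵇ p) (T-∧⁺ (≡⇒≡ᵇ j (suc i) q) (<⇒<ᵇ r))))
gEdge⇐ m k i j (start p q r) = T-∨ʳ ((i <ᵇ k) ∧ (j <ᵇ k))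
  (T-∨ʳ ((k ≤ᵇ i) ∧ (j ≡ᵇ suc i) ∧ (j <ᵇ m))
  (T-∨ˡ (T-∧⁺ (<⇒<ᵇ p) (T-∧⁺ (≡⇒≡ᵇ i 0 q) (≡⇒≡ᵇ j k r)))))
gEdge⇐ m k i j (end p q r) = T-∨ʳ ((i <ᵇ k) ∧ (j <ᵇ k))
  (T-∨ʳ ((k ≤ᵇ i) ∧ (j ≡ᵇ suc i) ∧ (j <ᵇ m))
  (T-∨ʳ ((k <ᵇ m) ∧ (i ≡ᵇ 0) ∧ (j ≡ᵇ k))
  (T-∧⁺ (<⇒<ᵇ p) (T-∧⁺ (≡⇒≡ᵇ i 1 q) (≡⇒≡ᵇ (suc j) m r)))))

Gmk-adj : ∀ {k} (u v : Fin m) {i j : ℕ} → toℕ u ≡ i → toℕ v ≡ j → i ≢ j →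
  GEdge m k i j ⊎ GEdge m k j i → Adj (Gmk m k) u v
Gmk-adj {m} {k} u v refl refl u≢v e with u FP.≟ v
... | yes u≡v = ⊥-elim (u≢v (cong toℕ u≡v))
... | no _ with e
... | inj₁ e = Equivalence.to T-≡ (T-∨ˡ (gEdge⇐ m k _ _ e))
... | inj₂ e = Equivalence.to T-≡ (T-∨ʳ (gEdge m k (toℕ u) (toℕ v)) (gEdge⇐ m k _ _ e))

Gmk-nonadj : ∀ {k} (u v : Fin m) {i j : ℕ} → toℕ u ≡ i → toℕ v ≡ j →
  ¬ GEdge m k i j → ¬ GEdge m k j i → adj (Gmk m k) u v ≡ false
Gmk-nonadj {m} {k} u v refl refl ¬e ¬e′ with u FP.≟ v
... | yes _ = refl
... | no _  = ¬-not λ e → [ ¬e ∘ gEdge⇒ m k _ _ , ¬e′ ∘ gEdge⇒ m k _ _ ]′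
  (T-∨⁻ {gEdge m k (toℕ u) (toℕ v)} (Equivalence.from T-≡ e))

module _ {m k i j : ℕ} (2≤k : 2 ≤ k) (k≤i : k ≤ i) (j<k : j < k) where

  -- `gEdge` lists every edge between clique and path from its clique end.
  no-backward : ¬ GEdge m k i j
  no-backward (clique i<k _)        = <⇒≱ i<k k≤i
  no-backward (internal _ refl _)   = <⇒≱ j<k (m≤n⇒m≤1+n k≤i)
  no-backward (start _ refl _)      = <⇒≱ 2≤k (m≤n⇒m≤1+n k≤i)
  no-backward (end _ refl _)        = <⇒≱ 2≤k k≤i

  forward-only : GEdge m k j i → (j ≡ 0 × i ≡ k) ⊎ (j ≡ 1 × suc i ≡ m)
  forward-only (clique _ i<k)     = ⊥-elim (<⇒≱ i<k k≤i)
  forward-only (internal k≤j _ _) = ⊥-elim (<⇒≱ j<k k≤j)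
  forward-only (start _ p q)      = inj₁ (p , q)
  forward-only (end _ p q)        = inj₂ (p , q)

Gmk-clique : ∀ {k} (κ : Fin k → Fin m) → (∀ i → toℕ (κ i) ≡ toℕ i) → IsClique (Gmk m k) κ
Gmk-clique κ κ-toℕ i j i≢j = Gmk-adj (κ i) (κ j) (κ-toℕ i) (κ-toℕ j) (i≢j ∘ FP.toℕ-injective)
  (inj₁ (clique (FP.toℕ<n i) (FP.toℕ<n j)))

ear₁-≅-Gmk : ∀ r → ear₁ r ≅ Gmk (2 + r + 1) (2 + r)
ear₁-≅-Gmk r = subst (λ m → ear₁ r ≅ Gmk m (2 + r)) (+-comm 1 (2 + r))
  (ear₁-≅ (Gmk (1 + k) k) inject₁ (fromℕ k) refl (Gmk-clique inject₁ FP.toℕ-inject₁)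
    (λ i → FP.fromℕ≢inject₁) N)
  where
  k = 2 + r
  2≤k : 2 ≤ k
  2≤k = s≤s (s≤s z≤n)
  N : ∀ j → firstTwo j ≡ adj (Gmk (1 + k) k) (fromℕ k) (inject₁ j)
  N zero       = sym (Gmk-adj (fromℕ k) zero (FP.toℕ-fromℕ k) refl (λ ()) (inj₂ (start ≤-refl refl refl)))
  N (suc zero) = sym (Gmk-adj (fromℕ k) (suc zero) (FP.toℕ-fromℕ k) refl (λ ()) (inj₂ (end ≤-refl refl refl)))
  N j@(suc (suc _)) = sym (Gmk-nonadj (fromℕ k) (inject₁ j) (FP.toℕ-fromℕ k) (FP.toℕ-inject₁ j)
    (no-backward 2≤k ≤-refl (FP.toℕ<n j))
    λ e → case-of (forward-only 2≤k ≤-refl (FP.toℕ<n j) e))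
    where
    case-of : (toℕ j ≡ 0 × k ≡ k) ⊎ (toℕ j ≡ 1 × suc k ≡ suc k) → ⊥
    case-of (inj₁ (() , _))
    case-of (inj₂ (() , _))

ear₂-≅-Gmk : ∀ r → ear₂ r ≅ Gmk (2 + r + 2) (2 + r)
ear₂-≅-Gmk r = subst (λ m → ear₂ r ≅ Gmk m (2 + r)) (+-comm 2 (2 + r))
  (ear₂-≅ (Gmk (2 + k) k) κ w w′ refl (Gmk-clique κ κ-toℕ)
    (λ i e → FP.fromℕ≢inject₁ (FP.inject₁-injective e)) (λ i → FP.fromℕ≢inject₁)
    (Gmk-adj w′ w w′-toℕ w-toℕ 1+n≢n (inj₂ (internal ≤-refl refl ≤-refl))) N N′)
  where
  k = 2 + r
  2≤k : 2 ≤ k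
  2≤k = s≤s (s≤s z≤n)
  κ : Fin k → Fin (2 + k)
  κ = inject₁ ∘ inject₁
  κ-toℕ : ∀ i → toℕ (κ i) ≡ toℕ i
  κ-toℕ i = trans (FP.toℕ-inject₁ (inject₁ i)) (FP.toℕ-inject₁ i)
  w w′ : Fin (2 + k)
  w  = inject₁ (fromℕ k)
  w′ = fromℕ (suc k)
  w-toℕ : toℕ w ≡ k
  w-toℕ = trans (FP.toℕ-inject₁ (fromℕ k)) (FP.toℕ-fromℕ k)
  w′-toℕ : toℕ w′ ≡ suc k
  w′-toℕ = FP.toℕ-fromℕ (suc k)
  N : ∀ j → first j ≡ adj (Gmk (2 + k) k) w (κ j)
  N zero = sym (Gmk-adj w zero w-toℕ refl (λ ()) (inj₂ (start (n≤1+n _) refl refl)))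
  N j@(suc _) = sym (Gmk-nonadj w (κ j) w-toℕ (κ-toℕ j) (no-backward 2≤k ≤-refl (FP.toℕ<n j))
    λ e → case-of (forward-only 2≤k ≤-refl (FP.toℕ<n j) e))
    where
    case-of : (toℕ j ≡ 0 × k ≡ k) ⊎ (toℕ j ≡ 1 × suc k ≡ suc (suc k)) → ⊥
    case-of (inj₁ (() , _))
    case-of (inj₂ (_ , e)) = 1+n≢n (sym e)
  N′ : ∀ j → second j ≡ adj (Gmk (2 + k) k) w′ (κ j)
  N′ (suc zero) = sym (Gmk-adj w′ (suc zero) w′-toℕ refl (λ ()) (inj₂ (end (n≤1+n _) refl refl)))
  N′ zero = sym (Gmk-nonadj w′ zero w′-toℕ refl (no-backward 2≤k (n≤1+n k) z<s)
    λ e → case-of (forward-only 2≤k (n≤1+n k) z<s e))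
    where
    case-of : (0 ≡ 0 × suc k ≡ k) ⊎ (0 ≡ 1 × suc (suc k) ≡ suc (suc k)) → ⊥
    case-of (inj₁ (_ , e)) = 1+n≢n e
  N′ j@(suc (suc _)) = sym (Gmk-nonadj w′ (κ j) w′-toℕ (κ-toℕ j) (no-backward 2≤k (n≤1+n k) (FP.toℕ<n j))
    λ e → case-of (forward-only 2≤k (n≤1+n k) (FP.toℕ<n j) e))
    where
    case-of : (toℕ j ≡ 0 × suc k ≡ k) ⊎ (toℕ j ≡ 1 × suc (suc k) ≡ suc (suc k)) → ⊥
    case-of (inj₁ (() , _))
    case-of (inj₂ (() , _))

-- Connectivity and independence

-- `Reach` keeps only the later vertices of a walk off `S`, hence the separate `u ∉ S`; it makes
-- both ends of the crossing edge avoid `S`.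
crossing : {G : Graph n} {S : Subset n} {C : Fin n → Set} (C? : Decidable C) {u v : Fin n} →
  Reach G S u v → u ∉ S → C u → ¬ C v →
  ∃ λ a → ∃ λ b → C a × ¬ C b × Adj G a b × a ∉ S × b ∉ S
crossing C? here u∉S Cu ¬Cv = ⊥-elim (¬Cv Cu)
crossing C? (step {v = w} u~w w∉S path) u∉S Cu ¬Cv with C? w
... | yes Cw = crossing C? path w∉S Cw ¬Cv
... | no ¬Cw = _ , w , Cu , ¬Cw , u~w , u∉S , w∉S

module _ (G : Graph n) (conn : KConnected G 2) where

  crossing-edge : {C : Fin n → Set} (C? : Decidable C) (u v : Fin n) → C u → ¬ C v →
    ∃ λ a → ∃ λ b → C a × ¬ C b × Adj G a b
  crossing-edge C? u v Cu ¬Cv =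
    let a , b , Ca , ¬Cb , a~b , _ = crossing C? (proj₂ conn (∅ {n}) ∣∅∣<2 u v ∉⊥ ∉⊥) ∉⊥ Cu ¬Cv
    in a , b , Ca , ¬Cb , a~b
    where
    ∣∅∣<2 : ∣ ∅ {n} ∣ < 2
    ∣∅∣<2 = subst (_< 2) (sym (∣⊥∣≡0 n)) z<s

  -- G stays connected without `p`; with `p` a known attachment vertex this yields a second one.
  crossing-edge-avoiding : (p : Fin n) {C : Fin n → Set} (C? : Decidable C) (u v : Fin n) →
    u ≢ p → v ≢ p → C u → ¬ C v →
    ∃ λ a → ∃ λ b → C a × ¬ C b × Adj G a b × a ≢ p × b ≢ p
  crossing-edge-avoiding p C? u v u≢p v≢p Cu ¬Cv =
    let a , b , Ca , ¬Cb , a~b , a∉ , b∉ =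
          crossing C? (proj₂ conn ⁅ p ⁆ ∣p∣<2 u v (x≢y⇒x∉⁅y⁆ u≢p) (x≢y⇒x∉⁅y⁆ v≢p)) (x≢y⇒x∉⁅y⁆ u≢p) Cu ¬Cv
    in a , b , Ca , ¬Cb , a~b , avoid a∉ , avoid b∉
    where
    ∣p∣<2 : ∣ ⁅ p ⁆ ∣ < 2
    ∣p∣<2 = subst (_< 2) (sym (∣⁅x⁆∣≡1 p)) ≤-refl
    avoid : ∀ {a} → a ∉ ⁅ p ⁆ → a ≢ p
    avoid a∉ refl = a∉ (x∈⁅x⁆ p)

NoIndependentTriple : Graph n → Set
NoIndependentTriple {n} G = ∀ (a b c : Fin n) → a ≢ b → a ≢ c → b ≢ c →
  ¬ Adj G a b → ¬ Adj G a c → ¬ Adj G b c → ⊥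

noIndependentTriple : (G : Graph n) → IndependenceNumber G 2 → NoIndependentTriple G
noIndependentTriple G (_ , maximal) a b c a≢b a≢c b≢c a≁b a≁c b≁c =
  <⇒≱ three (maximal S independent)
  where
  S = ⁅ a ⁆ ∪ (⁅ b ⁆ ∪ ⁅ c ⁆)
  elements : ∀ {v} → v ∈ S → v ≡ a ⊎ v ≡ b ⊎ v ≡ c
  elements v∈ with x∈p∪q⁻ ⁅ a ⁆ (⁅ b ⁆ ∪ ⁅ c ⁆) v∈
  ... | inj₁ v∈a = inj₁ (x∈⁅y⁆⇒x≡y a v∈a)
  ... | inj₂ v∈bc with x∈p∪q⁻ ⁅ b ⁆ ⁅ c ⁆ v∈bc
  ... | inj₁ v∈b = inj₂ (inj₁ (x∈⁅y⁆⇒x≡y b v∈b))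
  ... | inj₂ v∈c = inj₂ (inj₂ (x∈⁅y⁆⇒x≡y c v∈c))
  independent : Independent G S
  independent u v u∈ v∈ u~v with elements u∈ | elements v∈
  ... | inj₁ refl        | inj₁ refl        = Adj-irrefl G u~v refl
  ... | inj₁ refl        | inj₂ (inj₁ refl) = a≁b u~v
  ... | inj₁ refl        | inj₂ (inj₂ refl) = a≁c u~v
  ... | inj₂ (inj₁ refl) | inj₁ refl        = a≁b (Adj-sym G u~v)
  ... | inj₂ (inj₁ refl) | inj₂ (inj₁ refl) = Adj-irrefl G u~v refl
  ... | inj₂ (inj₁ refl) | inj₂ (inj₂ refl) = b≁c u~v
  ... | inj₂ (inj₂ refl) | inj₁ refl        = a≁c (Adj-sym G u~v)
  ... | inj₂ (inj₂ refl) | inj₂ (inj₁ refl) = b≁c (Adj-sym G u~v)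
  ... | inj₂ (inj₂ refl) | inj₂ (inj₂ refl) = Adj-irrefl G u~v refl
  a∈ : a ∈ S
  a∈ = x∈p∪q⁺ (inj₁ (x∈⁅x⁆ a))
  b∈ : b ∈ S - a
  b∈ = x∈p∧x≢y⇒x∈p-y (x∈p∪q⁺ (inj₂ (x∈p∪q⁺ (inj₁ (x∈⁅x⁆ b))))) (a≢b ∘ sym)
  c∈ : c ∈ S - a - b
  c∈ = x∈p∧x≢y⇒x∈p-y (x∈p∧x≢y⇒x∈p-y (x∈p∪q⁺ (inj₂ (x∈p∪q⁺ (inj₂ (x∈⁅x⁆ c))))) (a≢c ∘ sym)) (b≢c ∘ sym)
  -- Each of the three deletions strictly lowers the size.
  three : 2 < ∣ S ∣
  three = ≤-<-trans (≤-<-trans (≤-<-trans z≤n (x∈p⇒∣p-x∣<∣p∣ c∈)) (x∈p⇒∣p-x∣<∣p∣ b∈)) (x∈p⇒∣p-x∣<∣p∣ a∈)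

-- Growing a vertex list to the whole graph

∈ᶠ? : (v : Fin n) (σ : Fin m → Fin n) → Dec (v ∈ᶠ σ)
∈ᶠ? v σ = FP.any? λ i → σ i FP.≟ v

outside : (σ : Fin m → Fin n) → m < n → ∃ λ v → ¬ (v ∈ᶠ σ)
outside σ m<n with FP.any? (λ v → ¬? (∈ᶠ? v σ))
... | yes v∉ = v∉
... | no all = ⊥-elim (<⇒≱ m<n (surj⇒≥ σ λ v → decidable-stable (∈ᶠ? v σ) λ v∉ → all (v , v∉)))

∉ᶠ⇒≢ : {v : Fin n} {σ : Fin m → Fin n} → ¬ (v ∈ᶠ σ) → ∀ i → v ≢ σ i
∉ᶠ⇒≢ v∉ i e = v∉ (i , sym e)

surj-size : {σ : Fin m → Fin n} → m ≡ n → Inj σ → Surj σ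
surj-size {σ = σ} refl = inj⇒surj σ

-- While vertices are missing, some edge leaves the listed set, and its outer end costs at most x -
-- 1.
chromPoly-grow : (G : Graph n) (x : ℕ) → KConnected G 2 → ∀ t (σ : Fin (suc m) → Fin n) →
  t + suc m ≡ n → Inj σ → chromPoly G x ≤ (x ∸ 1) ^ℕ t * chromPoly (G [ σ ]) x
chromPoly-grow G x conn zero σ size σ-inj =
  ≤-trans (chromPoly-cover G x σ (surj-size size σ-inj)) (≤-reflexive (sym (+-identityʳ _)))
chromPoly-grow {n} {m} G x conn (suc t) σ size σ-inj =
  let v , v∉ = outside σ (subst (suc m <_) size (s≤s (m≤n+m (suc m) t)))
      a , b , a∈ , b∉ , a~b = crossing-edge G conn (λ v → ∈ᶠ? v σ) (σ zero) v (zero , refl) v∉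
  in begin
  chromPoly G x
    ≤⟨ chromPoly-grow G x conn t (b ∷ᶠ σ) (trans (+-suc t (suc m)) size) (∷-inj σ-inj (∉ᶠ⇒≢ {σ = σ} b∉)) ⟩
  (x ∸ 1) ^ℕ t * chromPoly (G [ b ∷ᶠ σ ]) x
    ≤⟨ *-monoʳ-≤ ((x ∸ 1) ^ℕ t) (step₁ G x σ a∈ (Adj-sym G a~b)) ⟩
  (x ∸ 1) ^ℕ t * ((x ∸ 1) * chromPoly (G [ σ ]) x)
    ≡⟨ trans (sym (*-assoc ((x ∸ 1) ^ℕ t) (x ∸ 1) _)) (cong (_* chromPoly (G [ σ ]) x) (*-comm ((x ∸ 1) ^ℕ t) (x ∸ 1))) ⟩
  (x ∸ 1) ^ℕ suc t * chromPoly (G [ σ ]) x ∎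
  where open ≤-Reasoning

-- Pigeonhole for three objects in two classes; the objects will be three vertices of the k-clique,
-- or three vertices of `B`.
majority : {P Q : Fin 3 → Set} → (∀ i → P i ⊎ Q i) →
  (∃ λ i → ∃ λ j → i ≢ j × P i × P j) ⊎ (∃ λ i → ∃ λ j → i ≢ j × Q i × Q j)
majority pq with pq zero | pq (suc zero) | pq (suc (suc zero))
... | inj₁ p | inj₁ p′ | _       = inj₁ (_ , _ , (λ ()) , p , p′)
... | inj₁ p | inj₂ q  | inj₁ p′ = inj₁ (_ , _ , (λ ()) , p , p′)
... | inj₁ p | inj₂ q  | inj₂ q′ = inj₂ (_ , _ , (λ ()) , q , q′)
... | inj₂ q | inj₂ q′ | _       = inj₂ (_ , _ , (λ ()) , q , q′)
... | inj₂ q | inj₁ p  | inj₁ p′ = inj₁ (_ , _ , (λ ()) , p , p′)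
... | inj₂ q | inj₁ p  | inj₂ q′ = inj₂ (_ , _ , (λ ()) , q , q′)

-- The ear models are attached at the first two clique positions, so a clique found in G has to be
-- reordered.
bringToFront : (i j : Fin (2 + r)) → i ≢ j →
  ∃ λ (π : Fin (2 + r) → Fin (2 + r)) → Inj π × π zero ≡ i × π (suc zero) ≡ j
bringToFront i j i≢j = i ∷ᶠ (punchIn i ∘ (j′ ∷ᶠ punchIn j′)) ,
  ∷-inj (∷-inj (λ {a} {b} → FP.punchIn-injective j′ a b) (λ a → FP.punchInᵢ≢i j′ a ∘ sym) ∘ FP.punchIn-injective i _ _)
    (λ a → FP.punchInᵢ≢i i _ ∘ sym) ,
  refl , FP.punchIn-punchOut i≢j
  where j′ = punchOut i≢j

clique-∘ : (G : Graph n) {κ : Fin m → Fin n} {π : Fin r → Fin m} → IsClique G κ → Inj π → IsClique G (κ ∘ π)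
clique-∘ G clq π-inj i j i≢j = clq _ _ (i≢j ∘ π-inj)

-- Graphs with a k-clique

-- Strict or extremal, rather than a weak bound with an equality clause: the inequality and the
-- forward direction of the equivalence are both read off from it.
Dichotomy : Graph n → ℕ → ℕ → Set
Dichotomy {n} G k x = chromPoly G x < falling x k * pathFactor x (n ∸ k) ⊎
  (G ≅ Gmk (k + 1) k ⊎ G ≅ Gmk (k + 2) k)

module WithClique (G : Graph n) (conn : KConnected G 2) (triple : NoIndependentTriple G) (r x : ℕ)
  (k≤x : 3 + r ≤ x) where

  k = 3 + r

  3≤x : 3 ≤ x
  3≤x = ≤-trans (m≤m+n 3 r) k≤x

  clique-colourings : {κ : Fin k → Fin n} → IsClique G κ → chromPoly (G [ κ ]) x ≡ falling x k
  clique-colourings {κ} clq = chromPoly-complete (G [ κ ]) x clq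

  -- `Dichotomy` with `l` in place of `n ∸ k`, so that `l` can be matched.
  Sharp : ℕ → Set
  Sharp l = chromPoly G x < falling x k * pathFactor x l ⊎ (G ≅ Gmk (k + 1) k ⊎ G ≅ Gmk (k + 2) k)

  -- An edge leaving `w` gives one clique neighbour, and deleting that neighbour gives a second. A
  -- third would leave at most x - 3 colours for `w`; otherwise the neighbourhood is exactly that of
  -- the ear.
  one-outside : (κ : Fin k → Fin n) → IsClique G κ → 1 + k ≡ n → Sharp 1
  one-outside κ₀ clq₀ size with outside κ₀ (≤-reflexive size)
  ... | w , w∉ with crossing-edge G conn (FP._≟ w) w (κ₀ zero) refl (w∉ ∘ (zero ,_))
  ... | a , p , refl , p≢w , w~p with surj-size size (∷-inj (clique-inj G clq₀) (∉ᶠ⇒≢ {σ = κ₀} w∉)) p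
  ... | zero , w≡p = ⊥-elim (p≢w (sym w≡p))
  ... | suc i , refl with crossing-edge-avoiding G conn (κ₀ i) (FP._≟ w) w (κ₀ i′) (p≢w ∘ sym)
                            (i′≢i ∘ clique-inj G clq₀) refl (w∉ ∘ (i′ ,_))
    where
    i′ = punchIn i zero
    i′≢i = FP.punchInᵢ≢i i zero
  ... | .w , q , refl , q≢w , w~q , _ , q≢p with surj-size size (∷-inj (clique-inj G clq₀) (∉ᶠ⇒≢ {σ = κ₀} w∉)) q
  ... | zero , w≡q = ⊥-elim (q≢w (sym w≡q))
  ... | suc j , refl with bringToFront i j (q≢p ∘ cong κ₀ ∘ sym)
  ... | π , π-inj , refl , refl = finish
    where
    κ = κ₀ ∘ π
    clq : IsClique G κ
    clq = clique-∘ G clq₀ π-inj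
    w≢κ : ∀ i → w ≢ κ i
    w≢κ i e = w∉ (π i , sym e)
    finish : Sharp 1
    finish with FP.any? (λ t → Adj? G w (κ (suc (suc t))))
    ... | yes (t , w~t) = inj₁ (begin-strict
      chromPoly G x
        ≤⟨ chromPoly-cover G x (w ∷ᶠ κ) (surj-size size (∷-inj (clique-inj G clq) w≢κ)) ⟩
      chromPoly (G [ w ∷ᶠ κ ]) x
        ≤⟨ chromPoly-suc-≤ (G [ w ∷ᶠ κ ]) x ι (clique-∘ G clq ι-inj)
             (λ { zero → w~p ; (suc zero) → w~q ; (suc (suc zero)) → w~t }) ⟩
      (x ∸ 3) * chromPoly (G [ κ ]) x
        ≡⟨ cong ((x ∸ 3) *_) (clique-colourings clq) ⟩
      (x ∸ 3) * falling x k
        ≡⟨ *-comm (x ∸ 3) (falling x k) ⟩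
      falling x k * (x ∸ 3)
        <⟨ *-monoʳ-< (falling x k) {{>-nonZero (falling-pos x k k≤x)}} (∸-monoʳ-< {x} ≤-refl 3≤x) ⟩
      falling x k * (x ∸ 2) ∎)
      where
      open ≤-Reasoning
      ι : Fin 3 → Fin k
      ι = zero ∷ᶠ suc zero ∷ᶠ suc (suc t) ∷ᶠ []ᶠ
      ι-inj : Inj ι
      ι-inj = ∷-inj (∷-inj (λ { {zero} {zero} _ → refl }) λ { zero () }) λ { zero () ; (suc zero) () }
    ... | no none = inj₂ (inj₁ (≅-trans G (ear₁ (suc r)) (Gmk (k + 1) k) (≅-sym (ear₁ (suc r)) G (ear₁-≅ G κ w size clq w≢κ N)) (ear₁-≅-Gmk (suc r))))
      where
      N : ∀ j → firstTwo j ≡ adj G w (κ j)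
      N zero          = sym w~p
      N (suc zero)    = sym w~q
      N (suc (suc t)) = sym (¬-not λ w~t → none (t , w~t))

  module _ (κ : Fin k → Fin n) (clq : IsClique G κ) where

    private
      κ? : ∀ v → Dec (v ∈ᶠ κ)
      κ? v = ∈ᶠ? v κ

    two-neighbours : ∀ l → 2 + l + k ≡ n → (w : Fin n) → ¬ (w ∈ᶠ κ) → (i j : Fin k) → i ≢ j →
      Adj G w (κ i) → Adj G w (κ j) → chromPoly G x < falling x k * pathFactor x (2 + l)
    two-neighbours l size w w∉ i j i≢j w~i w~j = below-bound x k l 3≤x k≤x (begin
      chromPoly G x
        ≤⟨ chromPoly-grow G x conn (suc l) (w ∷ᶠ κ) (trans (+-suc (suc l) k) size)
             (∷-inj (clique-inj G clq) (∉ᶠ⇒≢ {σ = κ} w∉)) ⟩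
      (x ∸ 1) ^ℕ suc l * chromPoly (G [ w ∷ᶠ κ ]) x
        ≤⟨ *-monoʳ-≤ ((x ∸ 1) ^ℕ suc l) (step₂ G x κ (i , refl) (j , refl) (clq i j i≢j) w~i w~j) ⟩
      (x ∸ 1) ^ℕ suc l * ((x ∸ 2) * chromPoly (G [ κ ]) x)
        ≡⟨ cong (λ e → (x ∸ 1) ^ℕ suc l * ((x ∸ 2) * e)) (clique-colourings clq) ⟩
      (x ∸ 1) ^ℕ suc l * ((x ∸ 2) * falling x k)
        ≡⟨ trans (sym (*-assoc ((x ∸ 1) ^ℕ suc l) (x ∸ 2) _)) (cong (_* falling x k) (*-comm ((x ∸ 1) ^ℕ suc l) (x ∸ 2))) ⟩
      (x ∸ 2) * (x ∸ 1) ^ℕ suc l * falling x k ∎)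
      where open ≤-Reasoning

    module OneNeighbour (unique : ∀ w → ¬ (w ∈ᶠ κ) → ∀ i j → Adj G w (κ i) → Adj G w (κ j) → i ≡ j) where

      -- Otherwise, as k ≥ 3, both would miss a common clique vertex.
      outside-adjacent : ∀ w w′ → ¬ (w ∈ᶠ κ) → ¬ (w′ ∈ᶠ κ) → w ≢ w′ → Adj G w w′
      outside-adjacent w w′ w∉ w′∉ w≢w′ with Adj? G w w′
      ... | yes w~w′ = w~w′
      ... | no w≁w′ = ⊥-elim (absurd (majority {λ i → Adj G w (κ (three i))} {λ i → Adj G w′ (κ (three i))} either))
        where
        three : Fin 3 → Fin k
        three = _↑ˡ r
        either : ∀ i → Adj G w (κ (three i)) ⊎ Adj G w′ (κ (three i))
        either i with Adj? G w (κ (three i)) | Adj? G w′ (κ (three i))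
        ... | yes w~  | _        = inj₁ w~
        ... | no _    | yes w′~  = inj₂ w′~
        ... | no w≁   | no w′≁   = ⊥-elim (triple w w′ (κ (three i)) w≢w′ (∉ᶠ⇒≢ {σ = κ} w∉ _) (∉ᶠ⇒≢ {σ = κ} w′∉ _) w≁w′ w≁ w′≁)
        absurd : _ → ⊥
        absurd (inj₁ (i , j , i≢j , p , p′)) = i≢j (FP.↑ˡ-injective r i j (unique w w∉ _ _ p p′))
        absurd (inj₂ (i , j , i≢j , p , p′)) = i≢j (FP.↑ˡ-injective r i j (unique w′ w′∉ _ _ p p′))

      attached : k < n → ∃ λ w → ∃ λ i → ¬ (w ∈ᶠ κ) × Adj G w (κ i)
      attached k<n with outside κ k<n
      ... | v , v∉ with crossing-edge G conn κ? (κ zero) v (zero , refl) v∉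
      ... | .(κ i) , w , (i , refl) , w∉ , p~w = w , i , w∉ , Adj-sym G p~w

      next : ∀ w → 1 + k < n → ∃ λ w′ → w′ ≢ w × ¬ (w′ ∈ᶠ κ)
      next w k<n with outside (w ∷ᶠ κ) k<n
      ... | w′ , w′∉ = w′ , (λ e → w′∉ (zero , sym e)) , λ (i , e) → w′∉ (suc i , e)

      -- Say `w` hangs on `κ i`. Without `κ i` some edge still joins `w` or `w′` to the clique;
      -- uniqueness rules out `w`, so `w′` hangs on another `κ j`.
      two-outside : 2 + k ≡ n → Sharp 2
      two-outside size with attached (subst (k <_) size (n≤1+n (suc k)))
      ... | w , i , w∉ , w~i with next w (≤-reflexive size)
      ... | w′ , w′≢w , w′∉ with crossing-edge-avoiding G conn (κ i) (λ v → (v FP.≟ w) ⊎-dec (v FP.≟ w′))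
              w (κ i′) (∉ᶠ⇒≢ {σ = κ} w∉ i) (FP.punchInᵢ≢i i zero ∘ clique-inj G clq) (inj₁ refl)
              (λ { (inj₁ e) → w∉ (i′ , e) ; (inj₂ e) → w′∉ (i′ , e) })
        where i′ = punchIn i zero
      ... | a , b , a∈ , b∉ , a~b , _ , b≢p with surj-size size
              (∷-inj (∷-inj (clique-inj G clq) (∉ᶠ⇒≢ {σ = κ} w∉)) λ { zero → w′≢w ; (suc i) → ∉ᶠ⇒≢ {σ = κ} w′∉ i }) b
      ... | zero , w′≡b = ⊥-elim (b∉ (inj₂ (sym w′≡b)))
      ... | suc zero , w≡b = ⊥-elim (b∉ (inj₁ (sym w≡b)))
      ... | suc (suc j) , refl with a∈
      ... | inj₁ refl = ⊥-elim (b≢p (cong κ (unique w w∉ j i a~b w~i)))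
      ... | inj₂ refl with bringToFront i j (b≢p ∘ cong κ ∘ sym)
      ... | π , π-inj , refl , refl = inj₂ (inj₂ (≅-trans G (ear₂ (suc r)) (Gmk (k + 2) k) (≅-sym (ear₂ (suc r)) G
            (ear₂-≅ G (κ ∘ π) w w′ size (clique-∘ G clq π-inj) (∉ᶠ⇒≢ {σ = κ} w∉ ∘ π) (∉ᶠ⇒≢ {σ = κ} w′∉ ∘ π)
              (outside-adjacent w′ w w′∉ w∉ w′≢w) N N′)) (ear₂-≅-Gmk (suc r))))
        where
        N : ∀ j → first j ≡ adj G w (κ (π j))
        N zero    = sym w~i
        N (suc t) = sym (¬-not λ e → FP.0≢1+n (π-inj (unique w w∉ _ _ w~i e)))
        N′ : ∀ j → second j ≡ adj G w′ (κ (π j))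
        N′ (suc zero)    = sym a~b
        N′ zero          = sym (¬-not λ e → FP.0≢1+n (π-inj (unique w′ w′∉ _ _ e a~b)))
        N′ (suc (suc t)) = sym (¬-not λ e → FP.0≢1+n (FP.suc-injective (π-inj (unique w′ w′∉ _ _ a~b e))))

      -- The outside vertices are pairwise adjacent: `w` is attached to the clique, `w′` to `w`, and
      -- `w″` closes a triangle on `w w′`. The `l` others are attached by edges.
      three-outside : ∀ l → 3 + l + k ≡ n → chromPoly G x < falling x k * pathFactor x (3 + l)
      three-outside l size with attached (subst (k <_) size (s≤s (≤-trans (m≤n+m k l) (m≤n+m (l + k) 2))))
      ... | w , i , w∉ , w~i with next w (subst (1 + k <_) size (s≤s (s≤s (≤-trans (m≤n+m k l) (n≤1+n _)))))
      ... | w′ , w′≢w , w′∉ with outside (w′ ∷ᶠ w ∷ᶠ κ) (subst (2 + k <_) size (s≤s (s≤s (s≤s (m≤n+m k l)))))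
      ... | w″ , w″∉ = below-bound x k (suc l) 3≤x k≤x (begin
        chromPoly G x
          ≤⟨ chromPoly-grow G x conn l (w″ ∷ᶠ w′ ∷ᶠ w ∷ᶠ κ) size′
               (∷-inj (∷-inj (∷-inj (clique-inj G clq) (∉ᶠ⇒≢ {σ = κ} w∉))
                 λ { zero → w′≢w ; (suc i) → ∉ᶠ⇒≢ {σ = κ} w′∉ i }) (∉ᶠ⇒≢ {σ = w′ ∷ᶠ w ∷ᶠ κ} w″∉)) ⟩
        y ^ℕ l * chromPoly (G [ w″ ∷ᶠ w′ ∷ᶠ w ∷ᶠ κ ]) x
          ≤⟨ *-monoʳ-≤ (y ^ℕ l) (step₂ G x (w′ ∷ᶠ w ∷ᶠ κ) (zero , refl) (suc zero , refl) w′~w w″~w′ w″~w) ⟩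
        y ^ℕ l * ((x ∸ 2) * chromPoly (G [ w′ ∷ᶠ w ∷ᶠ κ ]) x)
          ≤⟨ *-monoʳ-≤ (y ^ℕ l) (*-monoʳ-≤ (x ∸ 2) (step₁ G x (w ∷ᶠ κ) (zero , refl) w′~w)) ⟩
        y ^ℕ l * ((x ∸ 2) * (y * chromPoly (G [ w ∷ᶠ κ ]) x))
          ≤⟨ *-monoʳ-≤ (y ^ℕ l) (*-monoʳ-≤ (x ∸ 2) (*-monoʳ-≤ y (step₁ G x κ (i , refl) w~i))) ⟩
        y ^ℕ l * ((x ∸ 2) * (y * (y * chromPoly (G [ κ ]) x)))
          ≡⟨ cong (λ e → y ^ℕ l * ((x ∸ 2) * (y * (y * e)))) (clique-colourings clq) ⟩
        y ^ℕ l * ((x ∸ 2) * (y * (y * falling x k)))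
          ≡⟨ lemma (y ^ℕ l) (x ∸ 2) y (falling x k) ⟩
        (x ∸ 2) * (y * (y * y ^ℕ l)) * falling x k ∎)
        where
        open ≤-Reasoning
        y = x ∸ 1
        lemma : ∀ a b c d → a * (b * (c * (c * d))) ≡ b * (c * (c * a)) * d
        lemma = solve-∀
        size′ : l + (3 + k) ≡ n
        size′ = trans (trans (sym (+-assoc l 3 k)) (cong (_+ k) (+-comm l 3))) size
        w″∉κ : ¬ (w″ ∈ᶠ κ)
        w″∉κ (i , e) = w″∉ (suc (suc i) , e)
        w′~w = outside-adjacent w′ w w′∉ w∉ w′≢w
        w″~w′ = outside-adjacent w″ w′ w″∉κ w′∉ λ e → w″∉ (zero , sym e)
        w″~w = outside-adjacent w″ w w″∉κ w∉ λ e → w″∉ (suc zero , sym e)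

    sharp : ∀ l → suc l + k ≡ n → Sharp (suc l)
    sharp zero size = one-outside κ clq size
    sharp (suc l) size with FP.any? (λ w → FP.any? λ i → FP.any? λ j →
        ¬? (κ? w) ×-dec ¬? (i FP.≟ j) ×-dec Adj? G w (κ i) ×-dec Adj? G w (κ j))
    ... | yes (w , i , j , w∉ , i≢j , w~i , w~j) = inj₁ (two-neighbours l size w w∉ i j i≢j w~i w~j)
    ... | no none with l
    ... | zero  = OneNeighbour.two-outside unique size
      where
      unique : ∀ w → ¬ (w ∈ᶠ κ) → ∀ i j → Adj G w (κ i) → Adj G w (κ j) → i ≡ j
      unique w w∉ i j w~i w~j = decidable-stable (i FP.≟ j) λ i≢j → none (w , i , j , w∉ , i≢j , w~i , w~j)
    ... | suc l = inj₁ (OneNeighbour.three-outside unique l size)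
      where
      unique : ∀ w → ¬ (w ∈ᶠ κ) → ∀ i j → Adj G w (κ i) → Adj G w (κ j) → i ≡ j
      unique w w∉ i j w~i w~j = decidable-stable (i FP.≟ j) λ i≢j → none (w , i , j , w∉ , i≢j , w~i , w~j)

dichotomy-clique : (G : Graph n) → KConnected G 2 → NoIndependentTriple G → ∀ k x → 3 ≤ k → k ≤ x → k < n →
  Clique G k → Dichotomy G k x
dichotomy-clique {n} G conn triple k@(suc (suc (suc r))) x (s≤s (s≤s (s≤s z≤n))) k≤x k<n (κ , clq) =
  go (n ∸ k) (m∸n+n≡m (<⇒≤ k<n))
  where
  go : ∀ l → l + k ≡ n → WithClique.Sharp G conn triple r x k≤x l
  go zero    k≡n  = ⊥-elim (<⇒≢ k<n k≡n)
  go (suc l) size = WithClique.sharp G conn triple r x k≤x κ clq l size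

-- Separating pairs

CliqueOn : Graph n → (Fin n → Set) → Set
CliqueOn G P = ∀ {w w′} → P w → P w′ → w ≢ w′ → Adj G w w′

NoEdges : Graph n → (Fin n → Set) → (Fin n → Set) → Set
NoEdges G P Q = ∀ {w w′} → P w → Q w′ → ¬ Adj G w w′

Full : Graph n → Fin n → (Fin n → Set) → Set
Full G s P = ∀ w → P w → Adj G s w

record Separation (G : Graph n) (u v : Fin n) (A B : Fin n → Set) : Set where
  field
    A?       : Decidable A
    B?       : Decidable B
    covering : ∀ w → (w ≡ u ⊎ w ≡ v) ⊎ (A w ⊎ B w)
    u≢v      : u ≢ v
    u∉A      : ¬ A u
    v∉A      : ¬ A v
    u∉B      : ¬ B u
    v∉B      : ¬ B v
    A-clique : CliqueOn G A
    B-clique : CliqueOn G B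
    no-edges : NoEdges G A B
    disjoint : ∀ w → A w → ¬ B w

swap-sides : {G : Graph n} {u v : Fin n} {A B : Fin n → Set} → Separation G u v A B → Separation G u v B A
swap-sides {G = G} s = record
  { A? = B? ; B? = A? ; covering = λ w → Data.Sum.map₂ swap (covering w) ; u≢v = u≢v
  ; u∉A = u∉B ; v∉A = v∉B ; u∉B = u∉A ; v∉B = v∉A ; A-clique = B-clique ; B-clique = A-clique
  ; no-edges = λ b a e → no-edges a b (Adj-sym G e) ; disjoint = λ w b a → disjoint w a b }
  where open Separation s

swap-cut : {G : Graph n} {u v : Fin n} {A B : Fin n → Set} → Separation G u v A B → Separation G v u A B
swap-cut s = record
  { A? = A? ; B? = B? ; covering = λ w → Data.Sum.map₁ swap (covering w) ; u≢v = u≢v ∘ sym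
  ; u∉A = v∉A ; v∉A = u∉A ; u∉B = v∉B ; v∉B = u∉B ; A-clique = A-clique ; B-clique = B-clique
  ; no-edges = no-edges ; disjoint = disjoint }
  where open Separation s

module _ (G : Graph n) (conn : Connectivity G 2) (3<n : 3 < n) (triple : NoIndependentTriple G) where

  private
    Near : Fin n → Fin n → Set
    Near c w = w ≡ c ⊎ Adj G c w

    near? : ∀ c → Decidable (Near c)
    near? c w = (w FP.≟ c) ⊎-dec Adj? G c w

    Leak : Subset n → Fin n → Fin n → Fin n → Set
    Leak S c a b = a ∉ S × b ∉ S × Near c a × ¬ Near c b × Adj G a b

    leak? : ∀ S c a b → Dec (Leak S c a b)
    leak? S c a b = ¬? (a ∈? S) ×-dec ¬? (b ∈? S) ×-dec near? c a ×-dec ¬? (near? c b) ×-dec Adj? G a b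

    -- The failure of 3-connectivity is a negation and yields no separating set by itself. This
    -- decidable substitute for unreachability lets `anySubset?` search for one: off `S`, the closed
    -- neighbourhood of `c` misses `d` and has no edge leaving it.
    Cut : Subset n → Set
    Cut S = ∣ S ∣ < 3 × ∃ λ c → ∃ λ d → c ∉ S × d ∉ S × ¬ Near c d × ¬ (∃ λ a → ∃ λ b → Leak S c a b)

    cut? : Decidable Cut
    cut? S = (∣ S ∣ <? 3) ×-dec FP.any? λ c → FP.any? λ d →
      ¬? (c ∈? S) ×-dec ¬? (d ∈? S) ×-dec ¬? (near? c d) ×-dec ¬? (FP.any? λ a → FP.any? λ b → leak? S c a b)

    -- Without a leak the closed neighbourhood of c is cut off; with one, α = 2 leads from the leak to d.
    no-cut⇒3-connected : ¬ ∃ Cut → KConnected G 3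
    no-cut⇒3-connected none = 3<n , λ S S<3 c d c∉ d∉ → reach S S<3 c d c∉ d∉
      where
      reach : ∀ S → ∣ S ∣ < 3 → ∀ c d → c ∉ S → d ∉ S → Reach G S c d
      reach S S<3 c d c∉ d∉ with near? c d
      ... | yes (inj₁ refl) = here
      ... | yes (inj₂ c~d)  = step c~d d∉ here
      ... | no far with FP.any? (λ a → FP.any? λ b → leak? S c a b)
      ... | no tight = ⊥-elim (none (S , S<3 , c , d , c∉ , d∉ , far , tight))
      ... | yes (a , b , a∉ , b∉ , near , b-far , a~b) = from-c near
        where
        from-b : Reach G S b d
        from-b with b FP.≟ d | Adj? G b d
        ... | yes refl | _       = here
        ... | no _     | yes b~d = step b~d d∉ here
        ... | no b≢d   | no b≁d  = ⊥-elim (triple c b d (b-far ∘ inj₁ ∘ sym) (far ∘ inj₁ ∘ sym) b≢d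
                                     (b-far ∘ inj₂) (far ∘ inj₂) b≁d)
        from-c : Near c a → Reach G S c d
        from-c (inj₁ refl) = step a~b b∉ from-b
        from-c (inj₂ c~a)  = step c~a a∉ (step a~b b∉ from-b)

  -- `A` is the closed neighbourhood of `c` off `S`, and `B` the rest. Two non-adjacent vertices of
  -- `A` would be independent together with `d`, two of `B` together with `c`. By 2-connectivity `S`
  -- has exactly two elements.
  separation : ∃ λ u → ∃ λ v → Σ (Fin n → Set) λ A → Σ (Fin n → Set) λ B → Separation G u v A B
  separation with anySubset? cut?
  ... | no none = ⊥-elim (proj₂ conn (no-cut⇒3-connected none))
  ... | yes (S , S<3 , c , d , c∉ , d∉ , far , tight) = build (nonempty? S)
    where
    S≮2 : ¬ ∣ S ∣ < 2
    S≮2 S<2 =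
      let a , b , a-near , b-far , a~b , a∉ , b∉ =
            crossing (near? c) (proj₂ (proj₁ conn) S S<2 c d c∉ d∉) c∉ (inj₁ refl) far
      in tight (a , b , a∉ , b∉ , a-near , b-far , a~b)
    A B : Fin n → Set
    A w = w ∉ S × Near c w
    B w = w ∉ S × ¬ Near c w
    no-edges : NoEdges G A B
    no-edges (a∉ , near) (b∉ , b-far) a~b = tight (_ , _ , a∉ , b∉ , near , b-far , a~b)
    d∈B : B d
    d∈B = d∉ , far
    A-clique : CliqueOn G A
    A-clique {w} {w′} a a′ w≢w′ = decidable-stable (Adj? G w w′) λ w≁w′ →
      triple w w′ d w≢w′ (λ { refl → far (proj₂ a) }) (λ { refl → far (proj₂ a′) })
        w≁w′ (no-edges a d∈B) (no-edges a′ d∈B)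
    B-clique : CliqueOn G B
    B-clique {w} {w′} (_ , b) (_ , b′) w≢w′ = decidable-stable (Adj? G w w′) λ w≁w′ →
      triple c w w′ (b ∘ inj₁ ∘ sym) (b′ ∘ inj₁ ∘ sym) w≢w′ (b ∘ inj₂) (b′ ∘ inj₂) w≁w′
    build : Dec _ → _
    build (no empty) = ⊥-elim (S≮2 (subst (_< 2) (sym (trans (cong ∣_∣ (Empty-unique empty)) (∣⊥∣≡0 n))) z<s))
    build (yes (u , u∈)) with nonempty? (S - u)
    ... | no empty = ⊥-elim (S≮2 (s≤s (subst (∣ S ∣ ≤_) (∣⁅x⁆∣≡1 u) (p⊆q⇒∣p∣≤∣q∣ S⊆u))))
      where
      S⊆u : S ⊆ ⁅ u ⁆
      S⊆u {w} w∈ with w FP.≟ u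
      ... | yes refl = x∈⁅x⁆ u
      ... | no w≢u   = ⊥-elim (empty (w , x∈p∧x≢y⇒x∈p-y w∈ w≢u))
    ... | yes (v , v∈) = u , v , A , B , record
      { A? = λ w → ¬? (w ∈? S) ×-dec near? c w ; B? = λ w → ¬? (w ∈? S) ×-dec ¬? (near? c w)
      ; covering = covering ; u≢v = λ { refl → x∉p-x v∈ }
      ; u∉A = λ a → proj₁ a u∈ ; v∉A = λ a → proj₁ a v∈S ; u∉B = λ b → proj₁ b u∈ ; v∉B = λ b → proj₁ b v∈S
      ; A-clique = A-clique ; B-clique = B-clique ; no-edges = no-edges
      ; disjoint = λ w a b → proj₂ b (proj₂ a) }
      where
      v∈S : v ∈ S
      v∈S = p─q⊆p S ⁅ u ⁆ v∈
      x∉p-x : ¬ (u ∈ S - u)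
      x∉p-x u∈ = <-irrefl (cong ∣_∣ (p─q─q≡p─q S ⁅ u ⁆)) (x∈p⇒∣p-x∣<∣p∣ u∈)
      covering : ∀ w → (w ≡ u ⊎ w ≡ v) ⊎ (A w ⊎ B w)
      covering w with w FP.≟ u | w FP.≟ v | w ∈? S
      ... | yes w≡u | _       | _ = inj₁ (inj₁ w≡u)
      ... | no _    | yes w≡v | _ = inj₁ (inj₂ w≡v)
      -- A third element of `S` would allow three strict deletions, against |S| < 3.
      ... | no w≢u  | no w≢v  | yes w∈ = ⊥-elim (<⇒≱ S<3
              (≤-<-trans (≤-<-trans (≤-<-trans z≤n (x∈p⇒∣p-x∣<∣p∣ (x∈p∧x≢y⇒x∈p-y (x∈p∧x≢y⇒x∈p-y w∈ w≢u) w≢v)))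
                (x∈p⇒∣p-x∣<∣p∣ v∈)) (x∈p⇒∣p-x∣<∣p∣ u∈)))
      ... | no _    | no _    | no w∉ with near? c w
      ... | yes near = inj₂ (inj₁ (w∉ , near))
      ... | no w-far = inj₂ (inj₂ (w∉ , w-far))

-- Colourings in which two non-adjacent parts share their colours

infixl 6 _∖_
_∖_ : (Fin n → Set) → Fin n → Fin n → Set
(P ∖ v) w = P w × w ≢ v

∖? : {P : Fin n → Set} → Decidable P → (v : Fin n) → Decidable (P ∖ v)
∖? P? v w = P? w ×-dec ¬? (w FP.≟ v)

∷-enumeration : {P : Fin n → Set} {v : Fin n} → Enumeration (P ∖ v) → P v → Enumeration P
∷-enumeration {P = P} {v} E Pv = record
  { size     = suc (size E)
  ; elem     = v ∷ᶠ elem E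
  ; elem-inj = ∷-inj (elem-inj E) (λ i e → proj₂ (sound E i) (sym e))
  ; sound    = λ { zero → Pv ; (suc i) → proj₁ (sound E i) }
  ; complete = complete′ }
  where
  complete′ : ∀ w → P w → w ∈ᶠ (v ∷ᶠ elem E)
  complete′ w Pw with w FP.≟ v
  ... | yes w≡v = zero , sym w≡v
  ... | no w≢v  = let i , e = complete E w (Pw , w≢v) in suc i , e

↑ˡ≢↑ʳ : ∀ {r q} (i : Fin r) (j : Fin q) → i ↑ˡ q ≢ r ↑ʳ j
↑ˡ≢↑ʳ {r} {q} i j e = <⇒≱ (FP.toℕ<n i) (begin
  r                ≤⟨ m≤m+n r (toℕ j) ⟩
  r + toℕ j        ≡⟨ FP.toℕ-↑ʳ r j ⟨
  toℕ (r ↑ʳ j)     ≡⟨ cong toℕ e ⟨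
  toℕ (i ↑ˡ q)     ≡⟨ FP.toℕ-↑ˡ i q ⟩
  toℕ i            ∎)
  where open ≤-Reasoning

module _ (G : Graph n) {P Q : Fin n → Set} (P? : Decidable P) (Q? : Decidable Q) (PQ : NoEdges G P Q)
  (s : ∀ w → ¬ P w → ¬ Q w → Fin r)
  (s-proper : ∀ w w′ p q p′ q′ → Adj G w w′ → s w p q ≢ s w′ p′ q′) where

  private
    E = enumerate P?
    F = enumerate Q?
    M = size E ⊔ size F

    -- The decisions are arguments so that `colour-proper` can match on them.
    colour : ∀ w → Dec (P w) → Dec (Q w) → Fin (r + M)
    colour w (yes p) _       = r ↑ʳ inject≤ (proj₁ (complete E w p)) (m≤m⊔n (size E) (size F))
    colour w (no _)  (yes q) = r ↑ʳ inject≤ (proj₁ (complete F w q)) (m≤n⊔m (size E) (size F))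
    colour w (no ¬p) (no ¬q) = s w ¬p ¬q ↑ˡ M

    same-index : {R : Fin n → Set} (D : Enumeration R) (le : size D ≤ M) {w w′ : Fin n} (a : R w) (b : R w′) →
      r ↑ʳ inject≤ (proj₁ (complete D w a)) le ≡ r ↑ʳ inject≤ (proj₁ (complete D w′ b)) le → w ≡ w′
    same-index D le a b e = trans (sym (proj₂ (complete D _ a))) (trans
      (cong (elem D) (FP.inject≤-injective le le _ _ (FP.↑ʳ-injective r _ _ e))) (proj₂ (complete D _ b)))

    colour-proper : ∀ w w′ p? q? p′? q′? → Adj G w w′ → colour w p? q? ≢ colour w′ p′? q′?
    colour-proper w w′ (yes p) _       (yes p′) _        w~ e = Adj-irrefl G w~ (same-index E (m≤m⊔n _ _) p p′ e)
    colour-proper w w′ (yes p) _       (no _)   (yes q′) w~ e = PQ p q′ w~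
    colour-proper w w′ (yes p) _       (no _)   (no _)   w~ e = ↑ˡ≢↑ʳ _ _ (sym e)
    colour-proper w w′ (no _)  (yes q) (yes p′) _        w~ e = PQ p′ q (Adj-sym G w~)
    colour-proper w w′ (no _)  (yes q) (no _)   (yes q′) w~ e = Adj-irrefl G w~ (same-index F (m≤n⊔m (size E) _) q q′ e)
    colour-proper w w′ (no _)  (yes q) (no _)   (no _)   w~ e = ↑ˡ≢↑ʳ _ _ (sym e)
    colour-proper w w′ (no _)  (no _)  (yes p′) _        w~ e = ↑ˡ≢↑ʳ _ _ e
    colour-proper w w′ (no _)  (no _)  (no _)   (yes q′) w~ e = ↑ˡ≢↑ʳ _ _ e
    colour-proper w w′ (no p)  (no q)  (no p′)  (no q′)  w~ e =
      s-proper w w′ p q p′ q′ w~ (FP.↑ˡ-injective M _ _ e)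

  -- `P` and `Q` draw on one palette, each vertex taking its index in the enumeration of its part;
  -- equal colours across the parts are harmless as no edge joins them. The `r` colours of `s` form
  -- a disjoint palette.
  shared-colouring : Colourable G (r + (size (enumerate P?) ⊔ size (enumerate Q?)))
  shared-colouring = (λ w → colour w (P? w) (Q? w)) ,
    λ w w′ → colour-proper w w′ (P? w) (Q? w) (P? w′) (Q? w′)

module _ (G : Graph n) (k : ℕ) (minimal : ∀ j → j < k → ¬ Colourable G j) where

  private
    split : ∀ r p q → Colourable G (r + (p ⊔ q)) → k ≤ r + p ⊎ k ≤ r + q
    split r p q col with ≤-total p q
    ... | inj₁ p≤q = inj₂ (subst (λ e → k ≤ r + e) (m≤n⇒m⊔n≡n p≤q) (≮⇒≥ λ lt → minimal _ lt col))
    ... | inj₂ q≤p = inj₁ (subst (λ e → k ≤ r + e) (m≥n⇒m⊔n≡m q≤p) (≮⇒≥ λ lt → minimal _ lt col))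

  module _ {P Q : Fin n → Set} (P? : Decidable P) (Q? : Decidable Q) (PQ : NoEdges G P Q) where

    -- The two leftover vertices share a colour. Minimality bounds k by 1 plus the larger size,
    -- which is one of the two.
    one-pair : ∀ {c c′} → ¬ Adj G c c′ → (∀ w → ¬ P w → ¬ Q w → w ≡ c ⊎ w ≡ c′) →
      k ≤ 1 + size (enumerate P?) ⊎ k ≤ 1 + size (enumerate Q?)
    one-pair {c} {c′} c≁c′ rest = split 1 _ _ (shared-colouring G P? Q? PQ (λ _ _ _ → zero)
      λ w w′ p q p′ q′ w~ _ → independent (rest w p q) (rest w′ p′ q′) w~)
      where
      independent : ∀ {w w′} → w ≡ c ⊎ w ≡ c′ → w′ ≡ c ⊎ w′ ≡ c′ → ¬ Adj G w w′
      independent (inj₁ refl) (inj₁ refl) e = Adj-irrefl G e refl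
      independent (inj₁ refl) (inj₂ refl) e = c≁c′ e
      independent (inj₂ refl) (inj₁ refl) e = c≁c′ (Adj-sym G e)
      independent (inj₂ refl) (inj₂ refl) e = Adj-irrefl G e refl

    -- The members of a pair may coincide, which is how a class with one vertex is passed. In the
    -- applications the pairs are chosen so that the two alternatives can be compared with sizes of
    -- cliques in G.
    two-pairs : ∀ {c c′ d d′} → ¬ Adj G c c′ → ¬ Adj G d d′ →
      (∀ w → ¬ P w → ¬ Q w → (w ≡ c ⊎ w ≡ c′) ⊎ (w ≡ d ⊎ w ≡ d′)) →
      k ≤ 2 + size (enumerate P?) ⊎ k ≤ 2 + size (enumerate Q?)
    two-pairs {c} {c′} {d} {d′} c≁c′ d≁d′ rest = split 2 _ _ (shared-colouring G P? Q? PQ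
      (λ w p q → class (rest w p q)) λ w w′ p q p′ q′ → independent (rest w p q) (rest w′ p′ q′))
      where
      class : {X Y : Set} → X ⊎ Y → Fin 2
      class (inj₁ _) = zero
      class (inj₂ _) = suc zero
      independent : ∀ {w w′} (a : (w ≡ c ⊎ w ≡ c′) ⊎ (w ≡ d ⊎ w ≡ d′))
        (b : (w′ ≡ c ⊎ w′ ≡ c′) ⊎ (w′ ≡ d ⊎ w′ ≡ d′)) → Adj G w w′ → class a ≢ class b
      independent (inj₁ (inj₁ refl)) (inj₁ (inj₁ refl)) e _ = Adj-irrefl G e refl
      independent (inj₁ (inj₁ refl)) (inj₁ (inj₂ refl)) e _ = c≁c′ e
      independent (inj₁ (inj₂ refl)) (inj₁ (inj₁ refl)) e _ = c≁c′ (Adj-sym G e)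
      independent (inj₁ (inj₂ refl)) (inj₁ (inj₂ refl)) e _ = Adj-irrefl G e refl
      independent (inj₂ (inj₁ refl)) (inj₂ (inj₁ refl)) e _ = Adj-irrefl G e refl
      independent (inj₂ (inj₁ refl)) (inj₂ (inj₂ refl)) e _ = d≁d′ e
      independent (inj₂ (inj₂ refl)) (inj₂ (inj₁ refl)) e _ = d≁d′ (Adj-sym G e)
      independent (inj₂ (inj₂ refl)) (inj₂ (inj₂ refl)) e _ = Adj-irrefl G e refl

-- From a separating pair to a k-clique or the exceptional structure

shrink : (G : Graph n) {k m : ℕ} → k ≤ m → Clique G m → Clique G k
shrink G k≤m (κ , clq) = (λ i → κ (inject≤ i k≤m)) ,
  clique-∘ G clq λ {i} {j} → FP.inject≤-injective k≤m k≤m i j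

module _ (G : Graph n) {P : Fin n → Set} (E : Enumeration P) (P-clique : CliqueOn G P) where

  clique₀ : Clique G (size E)
  clique₀ = elem E , λ i j i≢j → P-clique (sound E i) (sound E j) (i≢j ∘ elem-inj E)

  clique₁ : ∀ {c} → Full G c P → Clique G (1 + size E)
  clique₁ {c} c-full = c ∷ᶠ elem E , ∷-clique G (proj₂ clique₀) λ i → c-full _ (sound E i)

  clique₂ : ∀ {c d} → Adj G c d → Full G c P → Full G d P → Clique G (2 + size E)
  clique₂ {c} {d} c~d c-full d-full = c ∷ᶠ d ∷ᶠ elem E ,
    ∷-clique G (proj₂ (clique₁ d-full)) λ { zero → c~d ; (suc i) → c-full _ (sound E i) }

-- The only way for a graph as in the theorem to have clique number below its chromatic number.
record Exceptional (G : Graph n) (k : ℕ) : Set₁ where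
  field
    {u v}   : Fin n
    {A B}   : Fin n → Set
    sep     : Separation G u v A B
    u≁v     : ¬ Adj G u v
    u-full  : Full G u A
    v-full  : Full G v A
    B-near  : ∀ w → B w → Adj G u w ⊎ Adj G v w
  open Separation sep public
  field
    A-size  : k ≡ 2 + size (enumerate A?)
    B-size  : k ≡ 1 + size (enumerate B?)

module _ (G : Graph n) (k : ℕ) (minimal : ∀ j → j < k → ¬ Colourable G j) (triple : NoIndependentTriple G) where

  private
    Result : Set₁
    Result = Clique G k ⊎ Exceptional G k

    irr : ∀ {w} → ¬ Adj G w w
    irr e = Adj-irrefl G e refl

    choose : ∀ {p q} → Clique G p → Clique G q → k ≤ p ⊎ k ≤ q → Clique G k
    choose cp cq (inj₁ k≤p) = shrink G k≤p cp
    choose cp cq (inj₂ k≤q) = shrink G k≤q cq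

    missing? : (s : Fin n) {B : Fin n → Set} → Decidable B → (∃ λ b → B b × ¬ Adj G s b) ⊎ Full G s B
    missing? s B? with FP.any? (λ b → B? b ×-dec ¬? (Adj? G s b))
    ... | yes b   = inj₁ b
    ... | no none = inj₂ λ b Bb → decidable-stable (Adj? G s b) λ s≁b → none (b , Bb , s≁b)

  module OnA {u v : Fin n} {A B : Fin n → Set} (sep : Separation G u v A B)
    (u-full : Full G u A) (v-full : Full G v A) where
    open Separation sep

    -- As a vertex set this is just `B`; its size is written to match `paired`.
    right : ∀ b b′ → B b → B b′ → b ≢ b′ → Clique G (2 + size (enumerate (∖? (∖? B? b) b′)))
    right b b′ Bb Bb′ b≢b′ = clique₂ G (enumerate (∖? (∖? B? b) b′))
      (λ q q′ → B-clique (proj₁ (proj₁ q)) (proj₁ (proj₁ q′)))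
      (B-clique Bb Bb′ b≢b′)
      (λ w q → B-clique Bb (proj₁ (proj₁ q)) (proj₂ (proj₁ q) ∘ sym))
      (λ w q → B-clique Bb′ (proj₁ (proj₁ q)) (proj₂ q ∘ sym))

    paired : ∀ b b′ → ¬ Adj G u b → ¬ Adj G v b′ →
      k ≤ 2 + size (enumerate A?) ⊎ k ≤ 2 + size (enumerate (∖? (∖? B? b) b′))
    paired b b′ u≁b v≁b′ =
      two-pairs G k minimal A? (∖? (∖? B? b) b′) (λ a q → no-edges a (proj₁ (proj₁ q))) u≁b v≁b′ rest
      where
      rest : ∀ w → ¬ A w → ¬ (B ∖ b ∖ b′) w → (w ≡ u ⊎ w ≡ b) ⊎ (w ≡ v ⊎ w ≡ b′)
      rest w ¬a ¬q with covering w | w FP.≟ b | w FP.≟ b′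
      ... | inj₁ (inj₁ w≡u) | _       | _        = inj₁ (inj₁ w≡u)
      ... | inj₁ (inj₂ w≡v) | _       | _        = inj₂ (inj₁ w≡v)
      ... | inj₂ (inj₁ a)   | _       | _        = ⊥-elim (¬a a)
      ... | inj₂ (inj₂ _)   | yes w≡b | _        = inj₁ (inj₂ w≡b)
      ... | inj₂ (inj₂ _)   | no _    | yes w≡b′ = inj₂ (inj₂ w≡b′)
      ... | inj₂ (inj₂ Bw)  | no w≢b  | no w≢b′  = ⊥-elim (¬q ((Bw , w≢b) , w≢b′))

    module Adjacent (u~v : Adj G u v) where

      EA = enumerate A?

      left : Clique G (2 + size EA)
      left = clique₂ G EA A-clique u~v u-full v-full

      distinct-missing : ∀ b b′ → B b → B b′ → b ≢ b′ → ¬ Adj G u b → ¬ Adj G v b′ → Clique G k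
      distinct-missing b b′ Bb Bb′ b≢b′ u≁b v≁b′ = choose left
        (right b b′ Bb Bb′ b≢b′) (paired b b′ u≁b v≁b′)

      rest₁ : ∀ b w → ¬ A w → ¬ (B ∖ b) w → w ≡ u ⊎ w ≡ v ⊎ w ≡ b
      rest₁ b w ¬a ¬q with covering w | w FP.≟ b
      ... | inj₁ (inj₁ w≡u) | _       = inj₁ w≡u
      ... | inj₁ (inj₂ w≡v) | _       = inj₂ (inj₁ w≡v)
      ... | inj₂ (inj₁ a)   | _       = ⊥-elim (¬a a)
      ... | inj₂ (inj₂ _)   | yes w≡b = inj₂ (inj₂ w≡b)
      ... | inj₂ (inj₂ Bw)  | no w≢b  = ⊥-elim (¬q (Bw , w≢b))

      -- Classes {u} and {v, b}; the matching cliques are A ∪ {u, v} and B ∪ {u}.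
      one-missing : ∀ b → B b → Full G u B → ¬ Adj G v b → Clique G k
      one-missing b Bb u-fullB v≁b = choose left
        (clique₂ G (enumerate (∖? B? b)) (λ q q′ → B-clique (proj₁ q) (proj₁ q′))
          (u-fullB b Bb) (λ w q → u-fullB w (proj₁ q)) (λ w q → B-clique Bb (proj₁ q) (proj₂ q ∘ sym)))
        (two-pairs G k minimal A? (∖? B? b) (λ a q → no-edges a (proj₁ q)) (irr {u}) v≁b
          λ w ¬a ¬q → [ inj₁ ∘ inj₁ , inj₂ ]′ (rest₁ b w ¬a ¬q))

      -- Classes {u, b} and {v}; on the side of `B` the clique drops `b` and takes both `u` and `v`.
      common-missing : ∀ b → ¬ Adj G u b → Full G u (B ∖ b) → Full G v (B ∖ b) → Clique G k
      common-missing b u≁b u-fullB v-fullB = choose left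
        (clique₂ G (enumerate (∖? B? b)) (λ q q′ → B-clique (proj₁ q) (proj₁ q′)) u~v u-fullB v-fullB)
        (two-pairs G k minimal A? (∖? B? b) (λ a q → no-edges a (proj₁ q)) u≁b (irr {v})
          λ w ¬a ¬q → [ inj₁ ∘ inj₁ , [ inj₂ ∘ inj₁ , inj₁ ∘ inj₂ ]′ ]′ (rest₁ b w ¬a ¬q))

      none-missing : Full G u B → Full G v B → Clique G k
      none-missing u-fullB v-fullB = choose left (clique₂ G (enumerate B?) B-clique u~v u-fullB v-fullB)
        (two-pairs G k minimal A? B? no-edges (irr {u}) (irr {v}) rest)
        where
        rest : ∀ w → ¬ A w → ¬ B w → (w ≡ u ⊎ w ≡ u) ⊎ (w ≡ v ⊎ w ≡ v)
        rest w ¬a ¬b with covering w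
        ... | inj₁ (inj₁ w≡u) = inj₁ (inj₁ w≡u)
        ... | inj₁ (inj₂ w≡v) = inj₂ (inj₁ w≡v)
        ... | inj₂ (inj₁ a)   = ⊥-elim (¬a a)
        ... | inj₂ (inj₂ b)   = ⊥-elim (¬b b)

    module NonAdjacent (u≁v : ¬ Adj G u v) where

      EA = enumerate A?
      EB = enumerate B?

      left : Clique G (1 + size EA)
      left = clique₁ G EA A-clique u-full

      B-near : ∀ w → B w → Adj G u w ⊎ Adj G v w
      B-near w Bw with Adj? G u w | Adj? G v w
      ... | yes u~w | _       = inj₁ u~w
      ... | no _    | yes v~w = inj₂ v~w
      ... | no u≁w  | no v≁w  = ⊥-elim (triple u v w u≢v (λ { refl → u∉B Bw }) (λ { refl → v∉B Bw }) u≁v u≁w v≁w)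

      contracted : k ≤ 1 + size EA ⊎ k ≤ 1 + size EB
      contracted = one-pair G k minimal A? B? no-edges u≁v rest
        where
        rest : ∀ w → ¬ A w → ¬ B w → w ≡ u ⊎ w ≡ v
        rest w ¬a ¬b with covering w
        ... | inj₁ w≡      = w≡
        ... | inj₂ (inj₁ a) = ⊥-elim (¬a a)
        ... | inj₂ (inj₂ b) = ⊥-elim (¬b b)

      distinct-missing : ∀ b b′ → B b → B b′ → ¬ Adj G u b → ¬ Adj G v b′ → Result
      distinct-missing b b′ Bb Bb′ u≁b v≁b′ = decide contracted (paired b b′ u≁b v≁b′)
        where
        b≢b′ : b ≢ b′
        b≢b′ refl = [ u≁b , v≁b′ ]′ (B-near b Bb)
        decide : k ≤ 1 + size EA ⊎ k ≤ 1 + size EB → k ≤ 2 + size EA ⊎ k ≤ 2 + size (enumerate (∖? (∖? B? b) b′)) → Result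
        decide (inj₁ k≤) _ = inj₁ (shrink G k≤ left)
        decide (inj₂ k≤1+B) (inj₂ k≤) = inj₁ (shrink G k≤ (right b b′ Bb Bb′ b≢b′))
        decide (inj₂ k≤1+B) (inj₁ k≤2+A) with k ≤? 1 + size EA | k ≤? size EB
        ... | yes k≤ | _      = inj₁ (shrink G k≤ left)
        ... | no _   | yes k≤ = inj₁ (shrink G k≤ (clique₀ G EB B-clique))
        ... | no k≰  | no k≰′ = inj₂ record
          { sep = sep ; u≁v = u≁v ; u-full = u-full ; v-full = v-full ; B-near = B-near
          ; A-size = ≤-antisym k≤2+A (≰⇒> k≰) ; B-size = ≤-antisym k≤1+B (≰⇒> k≰′) }

      some-full : ∀ {s} → Full G s B → Clique G k
      some-full s-full = choose left (clique₁ G EB B-clique s-full) contracted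

  both-on-A : {u v : Fin n} {A B : Fin n → Set} → Separation G u v A B → Full G u A → Full G v A → Result
  both-on-A {u} {v} {A} {B} sep u-full v-full with Adj? G u v
  ... | no u≁v = nonadjacent (missing? u B?) (missing? v B?)
    where
    open Separation sep
    open OnA.NonAdjacent sep u-full v-full u≁v
    nonadjacent : _ → _ → Result
    nonadjacent (inj₂ u-fullB)        _                      = inj₁ (some-full u-fullB)
    nonadjacent (inj₁ _)              (inj₂ v-fullB)         = inj₁ (some-full v-fullB)
    nonadjacent (inj₁ (b , Bb , u≁b)) (inj₁ (b′ , Bb′ , v≁b′)) = distinct-missing b b′ Bb Bb′ u≁b v≁b′
  ... | yes u~v = inj₁ (adjacent (missing? u B?) (missing? v B?))
    where
    open Separation sep
    open OnA.Adjacent sep u-full v-full u~v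
    both-missing : ∀ b b′ → B b → B b′ → ¬ Adj G u b → ¬ Adj G v b′ → Clique G k
    both-missing b b′ Bb Bb′ u≁b v≁b′ with b FP.≟ b′
    ... | no b≢b′ = distinct-missing b b′ Bb Bb′ b≢b′ u≁b v≁b′
    -- Here `b` is missed by both; any further vertex of `B` missed by `u` or `v` restores two
    -- distinct ones.
    ... | yes refl with missing? u (∖? B? b) | missing? v (∖? B? b)
    ... | inj₁ (c , (Bc , c≢b) , u≁c) | _ = distinct-missing c b Bc Bb c≢b u≁c v≁b′
    ... | inj₂ _ | inj₁ (c , (Bc , c≢b) , v≁c) = distinct-missing b c Bb Bc (c≢b ∘ sym) u≁b v≁c
    ... | inj₂ u-fullB | inj₂ v-fullB = common-missing b u≁b u-fullB v-fullB
    adjacent : _ → _ → Clique G k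
    adjacent (inj₂ u-fullB)        (inj₂ v-fullB)           = none-missing u-fullB v-fullB
    adjacent (inj₂ u-fullB)        (inj₁ (b , Bb , v≁b))    = one-missing b Bb u-fullB v≁b
    adjacent (inj₁ (b , Bb , u≁b)) (inj₂ v-fullB)           =
      OnA.Adjacent.one-missing (swap-cut sep) v-full u-full (Adj-sym G u~v) b Bb v-fullB u≁b
    adjacent (inj₁ (b , Bb , u≁b)) (inj₁ (b′ , Bb′ , v≁b′)) = both-missing b b′ Bb Bb′ u≁b v≁b′

  -- Non-adjacent `u` and `v` share a colour, matching the cliques A ∪ {u} and B ∪ {v}. If they are
  -- adjacent and each misses a vertex of the far side, the classes {u, b} and {v, a} match the same
  -- cliques; otherwise both are full on one side.
  split-sides : {u v : Fin n} {A B : Fin n → Set} → Separation G u v A B → Full G u A → Full G v B → Result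
  split-sides {u} {v} {A} {B} sep u-full v-full with Adj? G u v
  ... | no u≁v = inj₁ (choose (clique₁ G (enumerate A?) A-clique u-full) (clique₁ G (enumerate B?) B-clique v-full)
      (one-pair G k minimal A? B? no-edges u≁v rest))
    where
    open Separation sep
    rest : ∀ w → ¬ A w → ¬ B w → w ≡ u ⊎ w ≡ v
    rest w ¬a ¬b with covering w
    ... | inj₁ w≡       = w≡
    ... | inj₂ (inj₁ a) = ⊥-elim (¬a a)
    ... | inj₂ (inj₂ b) = ⊥-elim (¬b b)
  ... | yes u~v = adjacent (missing? u B?) (missing? v A?)
    where
    open Separation sep
    adjacent : _ → _ → Result
    adjacent (inj₂ u-fullB) _ = both-on-A (swap-sides sep) u-fullB v-full
    adjacent (inj₁ _) (inj₂ v-fullA) = both-on-A sep u-full v-fullA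
    adjacent (inj₁ (b , Bb , u≁b)) (inj₁ (a , Aa , v≁a)) = inj₁ (choose
      (clique₂ G (enumerate (∖? A? a)) (λ p p′ → A-clique (proj₁ p) (proj₁ p′)) (u-full a Aa)
        (λ w p → u-full w (proj₁ p)) (λ w p → A-clique Aa (proj₁ p) (proj₂ p ∘ sym)))
      (clique₂ G (enumerate (∖? B? b)) (λ p p′ → B-clique (proj₁ p) (proj₁ p′)) (v-full b Bb)
        (λ w p → v-full w (proj₁ p)) (λ w p → B-clique Bb (proj₁ p) (proj₂ p ∘ sym)))
      (two-pairs G k minimal (∖? A? a) (∖? B? b) (λ p q → no-edges (proj₁ p) (proj₁ q)) u≁b v≁a rest))
      where
      rest : ∀ w → ¬ (A ∖ a) w → ¬ (B ∖ b) w → (w ≡ u ⊎ w ≡ b) ⊎ (w ≡ v ⊎ w ≡ a)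
      rest w ¬p ¬q with covering w | w FP.≟ b | w FP.≟ a
      ... | inj₁ (inj₁ w≡u) | _       | _       = inj₁ (inj₁ w≡u)
      ... | inj₁ (inj₂ w≡v) | _       | _       = inj₂ (inj₁ w≡v)
      ... | inj₂ _          | yes w≡b | _       = inj₁ (inj₂ w≡b)
      ... | inj₂ _          | no _    | yes w≡a = inj₂ (inj₂ w≡a)
      ... | inj₂ (inj₁ Aw)  | no _    | no w≢a  = ⊥-elim (¬p (Aw , w≢a))
      ... | inj₂ (inj₂ Bw)  | no w≢b  | no _    = ⊥-elim (¬q (Bw , w≢b))

  clique-or-exceptional : {u v : Fin n} {A B : Fin n → Set} → Separation G u v A B → Result
  clique-or-exceptional {u} {v} {A} {B} sep = go (full-side u u∉A u∉B) (full-side v v∉A v∉B)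
    where
    open Separation sep
    full-side : ∀ s → ¬ A s → ¬ B s → Full G s A ⊎ Full G s B
    full-side s s∉A s∉B with missing? s A? | missing? s B?
    ... | inj₂ full | _         = inj₁ full
    ... | inj₁ _    | inj₂ full = inj₂ full
    ... | inj₁ (a , Aa , s≁a) | inj₁ (b , Bb , s≁b) = ⊥-elim (triple s a b
            (λ { refl → s∉A Aa }) (λ { refl → s∉B Bb }) (λ { refl → disjoint a Aa Bb }) s≁a s≁b (no-edges Aa Bb))
    go : Full G u A ⊎ Full G u B → Full G v A ⊎ Full G v B → Result
    go (inj₁ uA) (inj₁ vA) = both-on-A sep uA vA
    go (inj₂ uB) (inj₂ vB) = both-on-A (swap-sides sep) uB vB
    go (inj₁ uA) (inj₂ vB) = split-sides sep uA vB
    go (inj₂ uB) (inj₁ vA) = split-sides (swap-cut sep) vA uB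

-- The exceptional graphs

relationGraph : {R : Fin n → Fin n → Set} → (∀ u v → Dec (R u v)) →
  (∀ {u v} → R u v → R v u) → (∀ {v} → ¬ R v v) → Graph n
relationGraph {R = R} R? R-sym R-irrefl = record
  { adj     = λ u v → does (R? u v)
  ; adj-sym = λ u v → does-sym (R? u v) (R? v u)
  ; irrefl  = λ v → dec-false (R? v v) R-irrefl }
  where
  does-sym : ∀ {u v} (p : Dec (R u v)) (q : Dec (R v u)) → does p ≡ does q
  does-sym (yes p) q = sym (dec-true q (R-sym p))
  does-sym (no ¬p) q = sym (dec-false q (¬p ∘ R-sym))

does⇒ : {P : Set} (P? : Dec P) → does P? ≡ true → P
does⇒ (yes p) _ = p

module _ (G : Graph n) (k x : ℕ) (4≤k : 4 ≤ k) (k≤x : k ≤ x) where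

  private
    3≤x : 3 ≤ x
    3≤x = ≤-trans (n≤1+n 3) (≤-trans 4≤k k≤x)

  module _ (exc : Exceptional G k) where
    open Exceptional exc

    private
      EA = enumerate A?
      EB = enumerate B?

    order-size : k + size EB ≡ n
    order-size = trans (cong (_+ size EB) A-size) (≤-antisym (FP.injective⇒≤ σ-inj) (surj⇒≥ σ σ-surj))
      where
      σ : Fin (2 + size EA + size EB) → Fin n
      σ = (u ∷ᶠ v ∷ᶠ (elem EA)) ⊕ elem EB
      σ-inj : Inj σ
      σ-inj = ⊕-inj
        (∷-inj (∷-inj (elem-inj EA) λ i e → v∉A (subst A (sym e) (sound EA i)))
          λ { zero → u≢v ; (suc i) e → u∉A (subst A (sym e) (sound EA i)) })
        (elem-inj EB)
        λ { zero j e → u∉B (subst B (sym e) (sound EB j))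
          ; (suc zero) j e → v∉B (subst B (sym e) (sound EB j))
          ; (suc (suc i)) j e → disjoint _ (sound EA i) (subst B (sym e) (sound EB j)) }
      σ-surj : Surj σ
      σ-surj w with covering w
      ... | inj₁ (inj₁ w≡u) = zero , sym w≡u
      ... | inj₁ (inj₂ w≡v) = suc zero , sym w≡v
      ... | inj₂ (inj₁ a) = let i , e = complete EA w a in
              map₂ (λ p → trans p e) (⊕-left (u ∷ᶠ v ∷ᶠ elem EA) (elem EB) (suc (suc i)))
      ... | inj₂ (inj₂ b) = let i , e = complete EB w b in
              map₂ (λ p → trans p e) (⊕-right (u ∷ᶠ v ∷ᶠ elem EA) (elem EB) i)

    private
      Same Different : (Fin n → Fin x) → Set
      Same c      = Proper G c × c u ≡ c v
      Different c = Proper G c × c u ≢ c v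

      same? : Decidable Same
      same? c = proper? G c ×-dec (c u FP.≟ c v)

      different? : Decidable Different
      different? c = proper? G c ×-dec ¬? (c u FP.≟ c v)

      #same #different : ℕ
      #same      = ∑ (allFuns n x) (λ c → ind (same? c))
      #different = ∑ (allFuns n x) (λ c → ind (different? c))

    chromPoly-split : chromPoly G x ≡ #same + #different
    chromPoly-split = trans (chromPoly-∑ G x) (trans
      (∑-cong (allFuns n x) λ c → ind-split (proper? G c) (c u FP.≟ c v)) (∑-+ (allFuns n x) _ _))

    -- Identifying u and v turns B ∪ {u} into a clique.
    same-≤ : ∀ a → A a →
      #same ≤ (x ∸ 2) ^ℕ size (enumerate (∖? A? a)) * ((x ∸ 1) * falling x (1 + size EB))
    same-≤ a Aa = begin
      #same
        ≤⟨ chromPoly-injection same? (H [ σ ]) σ σ-proper σ-inj ⟩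
      chromPoly (H [ σ ]) x
        ≤⟨ steps₂ H x (elem E′) (a ∷ᶠ κ) {a} {u} (zero , refl) (suc zero , refl)
             (adj⁺ (inj₁ (Adj-sym G (u-full a Aa))))
             (λ i → adj⁺ (inj₁ (A-clique (proj₁ (sound E′ i)) Aa (proj₂ (sound E′ i)))))
             (λ i → adj⁺ (inj₁ (Adj-sym G (u-full _ (proj₁ (sound E′ i)))))) ⟩
      (x ∸ 2) ^ℕ size E′ * chromPoly (H [ a ∷ᶠ κ ]) x
        ≤⟨ *-monoʳ-≤ ((x ∸ 2) ^ℕ size E′) (step₁ H x κ {a} {u} (zero , refl) (adj⁺ (inj₁ (Adj-sym G (u-full a Aa))))) ⟩
      (x ∸ 2) ^ℕ size E′ * ((x ∸ 1) * chromPoly (H [ κ ]) x)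
        ≡⟨ cong (λ e → (x ∸ 2) ^ℕ size E′ * ((x ∸ 1) * e)) (chromPoly-complete (H [ κ ]) x κ-clique) ⟩
      (x ∸ 2) ^ℕ size E′ * ((x ∸ 1) * falling x (1 + size EB)) ∎
      where
      open ≤-Reasoning
      R : Fin n → Fin n → Set
      R w w′ = Adj G w w′ ⊎ (w ≡ u × Adj G v w′) ⊎ (w′ ≡ u × Adj G v w)
      R? : ∀ w w′ → Dec (R w w′)
      R? w w′ = Adj? G w w′ ⊎-dec ((w FP.≟ u) ×-dec Adj? G v w′) ⊎-dec ((w′ FP.≟ u) ×-dec Adj? G v w)
      R-sym : ∀ {w w′} → R w w′ → R w′ w
      R-sym (inj₁ e)        = inj₁ (Adj-sym G e)
      R-sym (inj₂ (inj₁ e)) = inj₂ (inj₂ e)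
      R-sym (inj₂ (inj₂ e)) = inj₂ (inj₁ e)
      R-irrefl : ∀ {w} → ¬ R w w
      R-irrefl (inj₁ e)                 = Adj-irrefl G e refl
      R-irrefl (inj₂ (inj₁ (refl , e))) = u≁v (Adj-sym G e)
      R-irrefl (inj₂ (inj₂ (refl , e))) = u≁v (Adj-sym G e)
      H : Graph n
      H = relationGraph R? R-sym R-irrefl
      adj⁺ : ∀ {w w′} → R w w′ → Adj H w w′
      adj⁺ = dec-true (R? _ _)
      adj⁻ : ∀ {w w′} → Adj H w w′ → R w w′
      adj⁻ = does⇒ (R? _ _)
      E′ = enumerate (∖? A? a)
      κ : Fin (1 + size EB) → Fin n
      κ = u ∷ᶠ elem EB
      κ-clique : IsClique H κ
      κ-clique = ∷-clique H
        (λ i j i≢j → adj⁺ (inj₁ (proj₂ (clique₀ G EB B-clique) i j i≢j)))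
        λ i → adj⁺ ([ inj₁ , (λ v~ → inj₂ (inj₁ (refl , v~))) ]′ (B-near _ (sound EB i)))
      -- `v` is left out: its colour is that of `u`, which has taken over its neighbours.
      σ = elem E′ ⊕ (a ∷ᶠ κ)
      σ-proper : ∀ c → Same c → Proper (H [ σ ]) (c ∘ σ)
      σ-proper c (pr , cu≡cv) i j e = H-proper (adj⁻ e)
        where
        H-proper : ∀ {w w′} → R w w′ → c w ≢ c w′
        H-proper (inj₁ e)                  = pr _ _ e
        H-proper (inj₂ (inj₁ (refl , v~))) = pr _ _ v~ ∘ trans (sym cu≡cv)
        H-proper (inj₂ (inj₂ (refl , v~))) = pr _ _ v~ ∘ trans (sym cu≡cv) ∘ sym
      later : ∀ {w} → w ∈ᶠ (a ∷ᶠ κ) → w ∈ᶠ σ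
      later (i , e) = map₂ (λ p → trans p e) (⊕-right (elem E′) (a ∷ᶠ κ) i)
      u∈σ : u ∈ᶠ σ
      u∈σ = later (suc zero , refl)
      reach : ∀ w → w ≢ v → w ∈ᶠ σ
      reach w w≢v with covering w
      ... | inj₁ (inj₁ refl) = u∈σ
      ... | inj₁ (inj₂ w≡v)  = ⊥-elim (w≢v w≡v)
      ... | inj₂ (inj₂ b)    = let i , e = complete EB w b in later (suc (suc i) , e)
      ... | inj₂ (inj₁ Aw) with w FP.≟ a
      ... | yes refl = later (zero , refl)
      ... | no w≢a   = let i , e = complete E′ w (Aw , w≢a) in
                       map₂ (λ p → trans p e) (⊕-left (elem E′) (a ∷ᶠ κ) i)
      σ-inj : ∀ c d → Same c → Same d → c ∘ σ ≗ d ∘ σ → c ≗ d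
      σ-inj c d (_ , cu≡cv) (_ , du≡dv) c≗d w with w FP.≟ v
      ... | no w≢v   = let i , e = reach w w≢v in subst (λ w → c w ≡ d w) e (c≗d i)
      ... | yes refl = trans (sym cu≡cv) (trans
                         (let i , e = u∈σ in subst (λ w → c w ≡ d w) e (c≗d i)) du≡dv)

    -- Joining u and v turns A ∪ {u , v} into a clique.
    different-≤ : ∀ s b b′ → s ∈ᶠ (u ∷ᶠ v ∷ᶠ []ᶠ) → B b → B b′ → b ≢ b′ → Adj G s b → Adj G s b′ →
      #different ≤ (x ∸ 2) ^ℕ size (enumerate (∖? (∖? B? b) b′)) *
        ((x ∸ 2) * ((x ∸ 1) * falling x (2 + size EA)))
    different-≤ s b b′ s∈ Bb Bb′ b≢b′ s~b s~b′ = begin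
      #different
        ≤⟨ chromPoly-injection different? (H [ σ ]) σ σ-proper
             (λ c d _ _ c≗d w → let i , e = σ-surj w in subst (λ w → c w ≡ d w) e (c≗d i)) ⟩
      chromPoly (H [ σ ]) x
        ≤⟨ steps₂ H x (elem E′) (b′ ∷ᶠ b ∷ᶠ κ) {b} {b′} (suc zero , refl) (zero , refl)
             (adj⁺ (inj₁ (B-clique Bb Bb′ b≢b′)))
             (λ i → adj⁺ (inj₁ (B-clique (proj₁ (proj₁ (sound E′ i))) Bb (proj₂ (proj₁ (sound E′ i))))))
             (λ i → adj⁺ (inj₁ (B-clique (proj₁ (proj₁ (sound E′ i))) Bb′ (proj₂ (sound E′ i))))) ⟩
      (x ∸ 2) ^ℕ size E′ * chromPoly (H [ b′ ∷ᶠ b ∷ᶠ κ ]) x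
        -- `b′` closes a triangle with `b` and `s`; this is the extra factor x - 2 that the common
        -- neighbour `s` buys.
        ≤⟨ *-monoʳ-≤ ((x ∸ 2) ^ℕ size E′) (step₂ H x (b ∷ᶠ κ) {b′} {b} {s} (zero , refl) (let i , e = s∈κ in suc i , e)
             (adj⁺ (inj₁ (Adj-sym G s~b))) (adj⁺ (inj₁ (B-clique Bb′ Bb (b≢b′ ∘ sym)))) (adj⁺ (inj₁ (Adj-sym G s~b′)))) ⟩
      (x ∸ 2) ^ℕ size E′ * ((x ∸ 2) * chromPoly (H [ b ∷ᶠ κ ]) x)
        ≤⟨ *-monoʳ-≤ ((x ∸ 2) ^ℕ size E′) (*-monoʳ-≤ (x ∸ 2) (step₁ H x κ {b} {s} s∈κ (adj⁺ (inj₁ (Adj-sym G s~b))))) ⟩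
      (x ∸ 2) ^ℕ size E′ * ((x ∸ 2) * ((x ∸ 1) * chromPoly (H [ κ ]) x))
        ≡⟨ cong (λ e → (x ∸ 2) ^ℕ size E′ * ((x ∸ 2) * ((x ∸ 1) * e))) (chromPoly-complete (H [ κ ]) x κ-clique) ⟩
      (x ∸ 2) ^ℕ size E′ * ((x ∸ 2) * ((x ∸ 1) * falling x (2 + size EA))) ∎
      where
      open ≤-Reasoning
      R : Fin n → Fin n → Set
      R w w′ = Adj G w w′ ⊎ (w ≡ u × w′ ≡ v) ⊎ (w ≡ v × w′ ≡ u)
      R? : ∀ w w′ → Dec (R w w′)
      R? w w′ = Adj? G w w′ ⊎-dec ((w FP.≟ u) ×-dec (w′ FP.≟ v)) ⊎-dec ((w FP.≟ v) ×-dec (w′ FP.≟ u))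
      R-sym : ∀ {w w′} → R w w′ → R w′ w
      R-sym (inj₁ e)              = inj₁ (Adj-sym G e)
      R-sym (inj₂ (inj₁ (p , q))) = inj₂ (inj₂ (q , p))
      R-sym (inj₂ (inj₂ (p , q))) = inj₂ (inj₁ (q , p))
      R-irrefl : ∀ {w} → ¬ R w w
      R-irrefl (inj₁ e)              = Adj-irrefl G e refl
      R-irrefl (inj₂ (inj₁ (p , q))) = u≢v (trans (sym p) q)
      R-irrefl (inj₂ (inj₂ (p , q))) = u≢v (trans (sym q) p)
      H : Graph n
      H = relationGraph R? R-sym R-irrefl
      adj⁺ : ∀ {w w′} → R w w′ → Adj H w w′
      adj⁺ = dec-true (R? _ _)
      adj⁻ : ∀ {w w′} → Adj H w w′ → R w w′
      adj⁻ = does⇒ (R? _ _)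
      E′ = enumerate (∖? (∖? B? b) b′)
      κ : Fin (2 + size EA) → Fin n
      κ = u ∷ᶠ v ∷ᶠ elem EA
      s∈κ : s ∈ᶠ κ
      s∈κ = widen s∈
        where
        widen : s ∈ᶠ (u ∷ᶠ v ∷ᶠ []ᶠ) → s ∈ᶠ κ
        widen (zero , e)     = zero , e
        widen (suc zero , e) = suc zero , e
      κ-clique : IsClique H κ
      κ-clique = ∷-clique H
        (∷-clique H (λ i j i≢j → adj⁺ (inj₁ (proj₂ (clique₀ G EA A-clique) i j i≢j)))
          λ i → adj⁺ (inj₁ (v-full _ (sound EA i))))
        λ { zero → adj⁺ (inj₂ (inj₁ (refl , refl))) ; (suc i) → adj⁺ (inj₁ (u-full _ (sound EA i))) }
      σ = elem E′ ⊕ (b′ ∷ᶠ b ∷ᶠ κ)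
      σ-proper : ∀ c → Different c → Proper (H [ σ ]) (c ∘ σ)
      σ-proper c (pr , cu≢cv) i j e = H-proper (adj⁻ e)
        where
        H-proper : ∀ {w w′} → R w w′ → c w ≢ c w′
        H-proper (inj₁ e)                    = pr _ _ e
        H-proper (inj₂ (inj₁ (refl , refl))) = cu≢cv
        H-proper (inj₂ (inj₂ (refl , refl))) = cu≢cv ∘ sym
      later : ∀ {w} → w ∈ᶠ (b′ ∷ᶠ b ∷ᶠ κ) → w ∈ᶠ σ
      later (i , e) = map₂ (λ p → trans p e) (⊕-right (elem E′) (b′ ∷ᶠ b ∷ᶠ κ) i)
      σ-surj : Surj σ
      σ-surj w with covering w
      ... | inj₁ (inj₁ refl) = later (suc (suc zero) , refl)
      ... | inj₁ (inj₂ refl) = later (suc (suc (suc zero)) , refl)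
      ... | inj₂ (inj₁ Aw)   = let i , e = complete EA w Aw in later (suc (suc (suc (suc i))) , e)
      ... | inj₂ (inj₂ Bw) with w FP.≟ b | w FP.≟ b′
      ... | yes refl | _        = later (suc zero , refl)
      ... | no _     | yes refl = later (zero , refl)
      ... | no w≢b   | no w≢b′  = let i , e = complete E′ w ((Bw , w≢b) , w≢b′) in
                                  map₂ (λ p → trans p e) (⊕-left (elem E′) (b′ ∷ᶠ b ∷ᶠ κ) i)

    private
      -- Of three vertices of `B`, each adjacent to `u` or `v`, two are adjacent to the same one.
      -- Three are available because k ≥ 4.
      twoCommon : 3 ≤ size EB → ∃ λ s → ∃ λ b → ∃ λ b′ →
        s ∈ᶠ (u ∷ᶠ v ∷ᶠ []ᶠ) × B b × B b′ × b ≢ b′ × Adj G s b × Adj G s b′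
      twoCommon 3≤B with majority {λ i → Adj G u (three i)} {λ i → Adj G v (three i)} (λ i → B-near _ (sound EB _))
        where
        three : Fin 3 → Fin n
        three i = elem EB (inject≤ i 3≤B)
      ... | inj₁ (i , j , i≢j , p , q) = u , _ , _ , (zero , refl) , sound EB _ , sound EB _ ,
              (λ e → i≢j (FP.inject≤-injective 3≤B 3≤B i j (elem-inj EB e))) , p , q
      ... | inj₂ (i , j , i≢j , p , q) = v , _ , _ , (suc zero , refl) , sound EB _ , sound EB _ ,
              (λ e → i≢j (FP.inject≤-injective 3≤B 3≤B i j (elem-inj EB e))) , p , q

    -- Both base cliques have k = 1 + |B| = 2 + |A| vertices. With a′ = |A| - 1 = |B| - 2 and `y`,
    -- `z`, `F` as below, the two counts are at most z^a′ · yF and z^a′ · zyF. They add up to z^a′ ·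
    -- y²F because 1 + z = y; one factor z is kept and the others are raised to y.
    exceptional-< : chromPoly G x < falling x k * pathFactor x (n ∸ k)
    exceptional-< with twoCommon (s≤s⁻¹ (subst (4 ≤_) B-size 4≤k))
    ... | s , b , b′ , s∈ , Bb , Bb′ , b≢b′ , s~b , s~b′ =
      subst (λ l → chromPoly G x < falling x k * pathFactor x l) (sym order) (finish a′ refl 1≤a′)
      where
      a : Fin n
      a = elem EA (inject≤ {1} zero (s≤s⁻¹ (s≤s⁻¹ (≤-trans (n≤1+n 3) (subst (4 ≤_) A-size 4≤k)))))
      a′ b″ : ℕ
      a′ = size (enumerate (∖? A? a))
      b″ = size (enumerate (∖? (∖? B? b) b′))
      sizeA : size EA ≡ suc a′
      sizeA = size-cong EA (∷-enumeration (enumerate (∖? A? a)) (sound EA _)) (λ _ → id) (λ _ → id)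
      sizeB : size EB ≡ suc (suc b″)
      sizeB = size-cong EB (∷-enumeration (∷-enumeration (enumerate (∖? (∖? B? b) b′)) (Bb′ , b≢b′ ∘ sym)) Bb)
        (λ _ → id) (λ _ → id)
      k≡A : k ≡ 3 + a′
      k≡A = trans A-size (cong (2 +_) sizeA)
      k≡B : k ≡ 3 + b″
      k≡B = trans B-size (cong suc sizeB)
      b″≡a′ : b″ ≡ a′
      b″≡a′ = +-cancelˡ-≡ 3 b″ a′ (trans (sym k≡B) k≡A)
      1≤a′ : 1 ≤ a′
      1≤a′ = s≤s⁻¹ (s≤s⁻¹ (s≤s⁻¹ (subst (4 ≤_) k≡A 4≤k)))
      order : n ∸ k ≡ 2 + a′
      order = trans (cong (_∸ k) (sym order-size)) (trans (m+n∸m≡n k (size EB)) (trans sizeB (cong (2 +_) b″≡a′)))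
      -- `t` stands for `a′` so that 1 ≤ a′ can be used by matching; it supplies the factor z that
      -- is kept.
      finish : ∀ t → t ≡ a′ → 1 ≤ t → chromPoly G x < falling x k * pathFactor x (2 + t)
      finish (suc t) t≡ _ = below-bound x k (suc t) 3≤x k≤x (begin
        chromPoly G x
          ≡⟨ chromPoly-split ⟩
        #same + #different
          ≤⟨ +-mono-≤ (same-≤ a (sound EA _)) (different-≤ s b b′ s∈ Bb Bb′ b≢b′ s~b s~b′) ⟩
        z ^ℕ a′ * (y * falling x (1 + size EB)) + z ^ℕ b″ * (z * (y * falling x (2 + size EA)))
          ≡⟨ cong₂ (λ e e′ → z ^ℕ a′ * (y * falling x e) + z ^ℕ b″ * (z * (y * falling x e′))) (sym B-size) (sym A-size) ⟩
        z ^ℕ a′ * (y * F) + z ^ℕ b″ * (z * (y * F))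
          ≡⟨ cong₂ (λ e e′ → z ^ℕ e * (y * F) + z ^ℕ e′ * (z * (y * F))) (sym t≡) (trans b″≡a′ (sym t≡)) ⟩
        z ^ℕ suc t * (y * F) + z ^ℕ suc t * (z * (y * F))
          ≡⟨ factor z (z ^ℕ t) y F ⟩
        z ^ℕ t * (z * (suc z * (y * F)))
          ≡⟨ cong (λ e → z ^ℕ t * (z * (e * (y * F)))) 1+z≡y ⟩
        z ^ℕ t * (z * (y * (y * F)))
          ≤⟨ *-monoˡ-≤ (z * (y * (y * F))) (^-monoˡ-≤ t z≤y) ⟩
        y ^ℕ t * (z * (y * (y * F)))
          ≡⟨ collect (y ^ℕ t) z y F ⟩
        z * y ^ℕ suc (suc t) * F ∎)
        where
        open ≤-Reasoning
        y z F : ℕ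
        y = x ∸ 1
        z = x ∸ 2
        F = falling x k
        1+z≡y : suc z ≡ y
        1+z≡y = sym (+-∸-assoc 1 {x} {2} (≤-trans (n≤1+n 2) 3≤x))
        z≤y : z ≤ y
        z≤y = ∸-monoʳ-≤ x (n≤1+n 1)
        factor : ∀ z w y F → z * w * (y * F) + z * w * (z * (y * F)) ≡ w * (z * (suc z * (y * F)))
        factor = solve-∀
        collect : ∀ w z y F → w * (z * (y * (y * F))) ≡ z * (y * (y * w)) * F
        collect = solve-∀

-- The dichotomy, and the count at the extremal graphs

dichotomy : (G : Graph n) → ∀ k x → 4 ≤ k → k ≤ x → k < n → Connectivity G 2 →
  (∀ j → j < k → ¬ Colourable G j) → NoIndependentTriple G → Dichotomy G k x
dichotomy G k x 4≤k k≤x k<n conn minimal triple with separation G conn (<-trans 4≤k k<n) triple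
... | _ , _ , _ , _ , sep with clique-or-exceptional G k minimal triple sep
... | inj₁ clq = dichotomy-clique G (proj₁ conn) triple k x (≤-trans (n≤1+n 3) 4≤k) k≤x k<n clq
... | inj₂ exc = inj₁ (exceptional-< G k x 4≤k k≤x exc)

extremal : (G : Graph n) → ∀ k x → 2 ≤ k → k ≤ x → G ≅ Gmk (k + 1) k ⊎ G ≅ Gmk (k + 2) k →
  chromPoly G x ≡ falling x k * pathFactor x (n ∸ k)
extremal G k@(suc (suc r)) x (s≤s (s≤s z≤n)) k≤x (inj₁ G≅) with ↔⇒≡ (proj₁ G≅)
... | refl = begin
  chromPoly G x                           ≡⟨ chromPoly-≅ G (Gmk (k + 1) k) x G≅ ⟩
  chromPoly (Gmk (k + 1) k) x             ≡⟨ chromPoly-≅ (ear₁ r) (Gmk (k + 1) k) x (ear₁-≅-Gmk r) ⟨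
  chromPoly (ear₁ r) x                    ≡⟨ chromPoly-ear₁ r x ⟩
  falling x k * pathFactor x 1            ≡⟨ cong (λ l → falling x k * pathFactor x l) (sym (m+n∸m≡n k 1)) ⟩
  falling x k * pathFactor x (k + 1 ∸ k)  ∎
  where open ≡-Reasoning
extremal G k@(suc (suc r)) x (s≤s (s≤s z≤n)) k≤x (inj₂ G≅) with ↔⇒≡ (proj₁ G≅)
... | refl = begin
  chromPoly G x                           ≡⟨ chromPoly-≅ G (Gmk (k + 2) k) x G≅ ⟩
  chromPoly (Gmk (k + 2) k) x             ≡⟨ chromPoly-≅ (ear₂ r) (Gmk (k + 2) k) x (ear₂-≅-Gmk r) ⟨
  chromPoly (ear₂ r) x                    ≡⟨ chromPoly-ear₂ r x (≤-trans (s≤s (s≤s z≤n)) k≤x) ⟩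
  falling x k * pathFactor x 2            ≡⟨ cong (λ l → falling x k * pathFactor x l) (sym (m+n∸m≡n k 2)) ⟩
  falling x k * pathFactor x (k + 2 ∸ k)  ∎
  where open ≡-Reasoning

-- The signed form of the bound

open import Data.Integer using (ℤ; +_; -1ℤ; _^_; +≤+) renaming (_*_ to _*ℤ_; _+_ to _+ℤ_; _≤_ to _≤ℤ_; -_ to -ℤ_)
import Data.Integer.Properties as ℤ

-- A step of two adds x(x - 2)(x - 1)^(l+1) = (x - 1)^(l+3) - (x - 1)^(l+1), since x(x - 2) = (x -
-- 1)² - 1, while the sign returns.
pathFactor-closed : ∀ x l → 2 ≤ x →
  + (x * pathFactor x l) ≡ + ((x ∸ 1) ^ℕ (l + 1)) +ℤ -1ℤ ^ l
pathFactor-closed (suc (suc z)) zero    (s≤s (s≤s z≤n)) = cong +_ (begin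
  suc (suc z) * 1     ≡⟨ *-identityʳ _ ⟩
  suc (suc z)         ≡⟨ +-comm 1 (suc z) ⟩
  suc z + 1           ≡⟨ cong (_+ 1) (sym (*-identityʳ (suc z))) ⟩
  suc z * 1 + 1       ∎)
  where open ≡-Reasoning
pathFactor-closed (suc (suc z)) (suc zero) (s≤s (s≤s z≤n)) = begin
  + (suc (suc z) * z)                       ≡⟨ cong +_ (lemma z) ⟩
  + (z + z * suc z)                         ≡⟨⟩
  -- Inserting 1 - 1 holds by computation and exposes the square of `suc z`.
  (+ 1 +ℤ + (z + z * suc z)) +ℤ -1ℤ         ≡⟨ cong (λ w → + w +ℤ -1ℤ) (sym (cong (suc z *_) (*-identityʳ (suc z)))) ⟩
  + (suc z * (suc z * 1)) +ℤ -1ℤ            ∎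
  where
  open ≡-Reasoning
  lemma : ∀ z → suc (suc z) * z ≡ z + z * suc z
  lemma = solve-∀
pathFactor-closed x@(suc (suc z)) (suc (suc l)) 2≤x@(s≤s (s≤s z≤n)) = begin
  + (x * (z * W + q))                       ≡⟨ cong +_ (*-distribˡ-+ x (z * W) q) ⟩
  + (x * (z * W)) +ℤ + (x * q)              ≡⟨ cong (+ (x * (z * W)) +ℤ_) (pathFactor-closed x l 2≤x) ⟩
  + (x * (z * W)) +ℤ (+ (suc z ^ℕ (l + 1)) +ℤ s)
    ≡⟨ cong (λ e → + (x * (z * W)) +ℤ (+ (suc z ^ℕ e) +ℤ s)) (+-comm l 1) ⟩
  + (x * (z * W)) +ℤ (+ W +ℤ s)             ≡⟨ ℤ.+-assoc (+ (x * (z * W))) (+ W) s ⟨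
  + (x * (z * W) + W) +ℤ s                  ≡⟨ cong₂ (λ e e′ → + e +ℤ e′) (lemma z W) (square s) ⟩
  + (suc z * (suc z * W)) +ℤ (-1ℤ *ℤ (-1ℤ *ℤ s))
    ≡⟨ cong (λ e → + (suc z * (suc z * suc z ^ℕ e)) +ℤ (-1ℤ *ℤ (-1ℤ *ℤ s))) (+-comm 1 l) ⟩
  + (suc z ^ℕ (suc (suc l) + 1)) +ℤ -1ℤ ^ suc (suc l) ∎
  where
  open ≡-Reasoning
  W = suc z ^ℕ suc l
  q = pathFactor x l
  s = -1ℤ ^ l
  lemma : ∀ z W → suc (suc z) * (z * W) + W ≡ suc z * (suc z * W)
  lemma = solve-∀
  square : ∀ s → s ≡ -1ℤ *ℤ (-1ℤ *ℤ s)
  square s = sym (trans (ℤ.-1*i≡-i (-1ℤ *ℤ s)) (trans (cong -ℤ_ (ℤ.-1*i≡-i s)) (ℤ.neg-involutive s)))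

-- The leading factor x of (x)ₖ is the one that `pathFactor-closed` absorbs, which leaves the
-- falling factorial of x - 1.
bound-closed : ∀ x k l → 2 ≤ x → 1 ≤ k →
  + falling (x ∸ 1) (k ∸ 1) *ℤ (+ ((x ∸ 1) ^ℕ (l + 1)) +ℤ -1ℤ ^ l) ≡
  + (falling x k * pathFactor x l)
bound-closed x (suc k) l 2≤x 1≤k = begin
  + F *ℤ (+ ((x ∸ 1) ^ℕ (l + 1)) +ℤ -1ℤ ^ l)  ≡⟨ cong (+ F *ℤ_) (sym (pathFactor-closed x l 2≤x)) ⟩
  + F *ℤ + (x * pathFactor x l)               ≡⟨ ℤ.pos-* F (x * pathFactor x l) ⟨
  + (F * (x * pathFactor x l))                ≡⟨ cong +_ (trans (sym (*-assoc F x _)) (cong (_* pathFactor x l) (*-comm F x))) ⟩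
  + (x * F * pathFactor x l)                  ∎
  where
  open ≡-Reasoning
  F = falling (x ∸ 1) k

theorem3p9 : (k n : ℕ) → 4 ≤ k → k < n → (G : Graph n) →
    KConnected G 2 → ChromaticNumber G k → IndependenceNumber G 2 → Connectivity G 2 →
    (x : ℕ) → k ≤ x →
    let bound = (+ falling (x ∸ 1) (k ∸ 1)) *ℤ ((+ ((x ∸ 1) Data.Nat.^ (n ∸ k + 1))) +ℤ (-1ℤ ^ (n ∸ k)))
    in ((+ chromPoly G x) ≤ℤ bound)
    × (((+ chromPoly G x) ≡ bound) ⇔ ((G ≅ Gmk (k + 1) k) ⊎ (G ≅ Gmk (k + 2) k)))
theorem3p9 k n 4≤k k<n G _ (_ , minimal) α conn x k≤x =
  -- The signed bound is exchanged for its natural-number form in the inequality and the equivalence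
  -- at once.
  subst (λ b → + chromPoly G x ≤ℤ b × (+ chromPoly G x ≡ b ⇔ Extremal))
    (sym (bound-closed x k (n ∸ k) (≤-trans 2≤k k≤x) (≤-trans (n≤1+n 1) 2≤k)))
    (+≤+ ([ <⇒≤ , ≤-reflexive ∘ extremal G k x 2≤k k≤x ]′ cases) ,
     mk⇔ (λ e → [ (λ P< → ⊥-elim (<⇒≢ P< (ℤ.+-injective e))) , (λ iso → iso) ]′ cases)
         (cong +_ ∘ extremal G k x 2≤k k≤x))
  where
  Extremal : Set
  Extremal = (G ≅ Gmk (k + 1) k) ⊎ (G ≅ Gmk (k + 2) k)
  2≤k : 2 ≤ k
  2≤k = ≤-trans (s≤s (s≤s z≤n)) 4≤k
  cases : Dichotomy G k x
  cases = dichotomy G k x 4≤k k≤x k<n conn minimal (noIndependentTriple G α)
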